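{- Let $\mathcal{G}=(S,(P_\gamma)_{\gamma\in\Gamma},(V_p)_{p\in\Psi})$ be a game model whose state space $S$ is closed under the Souslin operation. Assume that $\mathcal{G}$ satisfies the Frege condition and that its state space is small. Then the equivalence relation $\rho$ induced by game logic on $S$ is a congruence for $\mathcal{G}$, and its factor map $\eta_\rho:\mathcal{G}\to\mathcal{G}/\rho$ is a model morphism.
   Context: A measurable space $S$ has a $\sigma$-algebra $\mathcal{B}(S)$; $[0,1]$ carries its Borel sets; $S\otimes T$ is the product space. $\mathrm{Sub}(S)$ is the set of subprobability measures on $S$ with the smallest $\sigma$-algebra making all $\mu\mapsto\mu(A)$, $A\in\mathcal{B}(S)$, measurable. For measurable $f:S\to T$, $\mathrm{Sub}(f)(\mu)(B):=\mu(f^{ -1}[B])$. $\boldsymbol\beta(A,>q):=\{\mu\in\mathrm{Sub}(S)\mid\mu(A)>q\}$. $\mathcal{V}(S)$ is the set of all upward closed $V\subseteq\mathcal{B}(\mathrm{Sub}(S))$. $P:S\to\mathcal{V}(S)$ is t-measurable iff $\{\langle s,q\rangle\in S\times[0,1]\mid H_q\in P(s)\}\in\mathcal{B}(S\otimes[0,1])$ for every $H\in\mathcal{B}(\mathrm{Sub}(S)\otimes[0,1])$, where $H_q:=\{\mu\mid\langle\mu,q\rangle\in H\}$; a stochastic effectivity function on $S$ is a t-measurable map $S\to\mathcal{V}(S)$. A morphism $f:P\to Q$ of stochastic effectivity functions $P$ on $S$, $Q$ on $T$ is a measurable $f:S\to T$ with $W\in Q(f(s))\Leftrightarrow\mathrm{Sub}(f)^{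 -1}[W]\in P(s)$ for all $s\in S$, $W\in\mathcal{B}(\mathrm{Sub}(T))$. $S$ is closed under the Souslin operation iff $\bigcup_{\alpha\in\mathbb{N}^{\mathbb{N}}}\bigcap_{n\in\mathbb{N}}A_{\alpha|n}\in\mathcal{B}(S)$ for every family $(A_v)$ in $\mathcal{B}(S)$ indexed by finite words $v$ over $\mathbb{N}$ ($\alpha|n$ = first $n$ letters of $\alpha$). Games: $\Gamma$ is the set of primitive games, containing the empty game $\epsilon$. Games: $\tau::=\gamma\mid\tau^d\mid\tau_1\cup\tau_2\mid\tau_1\cap\tau_2\mid\tau_1;\tau_2\mid\tau^*\mid\tau^\times$, $\gamma\in\Gamma$, identified according to: $(\tau^d)^d=\tau$; $\tau_1\cap\tau_2=(\tau_1^d\cup\tau_2^d)^d$; $(\tau^\times)^d=(\tau^d)^*$; $(\tau_1\cup\tau_2);\tau=\tau_1;\tau\cup\tau_2;\tau$; $(\tau_1;\tau_2)^d=\tau_1^d;\tau_2^d$; $\cup,\cap$ commutative and associative, $;$ associative; $\tau^*;\tau_0$ expands to $\tau_0\cup\tau;\tau_0\cup\tau;\tau;\tau_0\cup\dots$. A game frame $(S,(P_\gamma)_{\gamma\in\Gamma})$ has a measurable space $S$ and stochastic effectivity functions $P_\gamma$ on $S$, with $P_\epsilon(s)=\{W\mid\delta_s\in W\}$. With $Q^{(k)}(q):=\{\langle a_1,\dots,a_k\rangle\in\mathbb{Q}^k\mid a_i\geq0,\sum_ia_i\leq q\}$ ($0\leq k\leq\infty$), for $A\in\mathcal{B}(S)$,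 $q\geq0$ define recursively, modulo the identifications: (A) $\mathfrak{I}_{\mathcal{G}}(\gamma\mid A,q):=\{s\mid\boldsymbol\beta(A,>q)\in P_\gamma(s)\}$, $\gamma\in\Gamma$; (B) $\mathfrak{I}_{\mathcal{G}}(\tau^d\mid A,q):=S\setminus\mathfrak{I}_{\mathcal{G}}(\tau\mid S\setminus A,q)$; (C) $\mathfrak{I}_{\mathcal{G}}(\tau_1\cup\tau_2\mid A,q):=\bigcap_{a\in Q^{(2)}(q)}(\mathfrak{I}_{\mathcal{G}}(\tau_1\mid A,a_1)\cup\mathfrak{I}_{\mathcal{G}}(\tau_2\mid A,a_2))$; (D) $\mathfrak{I}_{\mathcal{G}}((\tau_1\cup\tau_2);\tau\mid A,q):=\mathfrak{I}_{\mathcal{G}}(\tau_1;\tau\cup\tau_2;\tau\mid A,q)$; (E) $\mathfrak{I}_{\mathcal{G}}(\gamma;\tau\mid A,q):=\{s\mid G_\tau(A,q)\in P_\gamma(s)\}$, $\gamma\in\Gamma$, with $G_\tau(A,q):=\{\mu\in\mathrm{Sub}(S)\mid\int_0^1\mu(\mathfrak{I}_{\mathcal{G}}(\tau\mid A,r))\,dr>q\}$; (F) $\mathfrak{I}_{\mathcal{G}}(\tau^*;\tau_0\mid A,q):=\bigcap_{a\in Q^{(\infty)}(q)}\bigcup_{n\geq0}\mathfrak{I}_{\mathcal{G}}(\tau^n;\tau_0\mid A,a_{n+1})$, with $\tau^n=\tau;\dots;\tau$ ($n$ times), $\tau^0;\tau_0=\tau_0$; bare $\tau^*$ is read as $\tau^*;\epsilon$.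 Game logic: formulas $\varphi::=\top\mid p\mid\varphi_1\wedge\varphi_2\mid\langle\tau\rangle_q\varphi$ with $p\in\Psi$ atomic propositions, $\tau$ a game, $q\in[0,1]$. A game model $\mathcal{G}=(S,(P_\gamma)_{\gamma\in\Gamma},(V_p)_{p\in\Psi})$ is a game frame together with sets $V_p\in\mathcal{B}(S)$. Validity sets: $[\![\top]\!]_{\mathcal{G}}=S$, $[\![p]\!]_{\mathcal{G}}=V_p$, $[\![\varphi_1\wedge\varphi_2]\!]_{\mathcal{G}}=[\![\varphi_1]\!]_{\mathcal{G}}\cap[\![\varphi_2]\!]_{\mathcal{G}}$, $[\![\langle\tau\rangle_q\varphi]\!]_{\mathcal{G}}=\mathfrak{I}_{\mathcal{G}}(\tau\mid[\![\varphi]\!]_{\mathcal{G}},q)$; $\mathcal{G},s\models\varphi$ iff $s\in[\![\varphi]\!]_{\mathcal{G}}$. A model morphism $f:(S,(P_\gamma),(V_p))\to(T,(Q_\gamma),(W_p))$ is a measurable $f:S\to T$ such that $f:P_\gamma\to Q_\gamma$ is a morphism for all $\gamma\in\Gamma$ and $f^{ -1}[W_p]=V_p$ for all $p\in\Psi$. Equivalences: for an equivalence relation $\rho$ on $S$, $\Sigma(\rho,S)$ is the $\sigma$-algebra of $\rho$-invariant sets in $\mathcal{B}(S)$ (unions of classes); $S/\rho$ carries the largest $\sigma$-algebra making $\eta_\rho:s\mapsto[s]_\rho$ measurable. $\rho$ is exact with $\mathcal{A}\subseteq\mathcal{B}(S)$ iff $\Sigma(\rho,S)=\sigma(\mathcal{A})$.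 On $S\times[0,1]$ let $\langle s,q\rangle\,(\rho\times\Delta)\,\langle s',q'\rangle$ iff $s\,\rho\,s'$ and $q=q'$. $\rho$ is tame iff for some $\mathcal{A}\subseteq\mathcal{B}(S)$, $\rho$ is exact with $\mathcal{A}$ and $\rho\times\Delta$ is exact with $\{A\times I\mid A\in\mathcal{A},I\subseteq[0,1]\text{ an interval}\}$. $\rho$ is a congruence for a stochastic effectivity function $P$ on $S$ iff there is a (necessarily unique) stochastic effectivity function $P_\rho$ on $S/\rho$ such that $\eta_\rho:P\to P_\rho$ is a morphism. $\rho$ is a congruence for $\mathcal{G}$ iff $V_p\in\Sigma(\rho,S)$ for all $p$ and $\rho$ is a congruence for each $P_\gamma$; then $\mathcal{G}/\rho:=(S/\rho,((P_\gamma)_\rho)_{\gamma\in\Gamma},(\eta_\rho[V_p])_{p\in\Psi})$. The equivalence $\rho$ induced by the logic: $s\,\rho\,s'$ iff $\{\varphi\mid\mathcal{G},s\models\varphi\}=\{\varphi\mid\mathcal{G},s'\models\varphi\}$. The state space (and the model) is small iff $\rho$ is tame and exact with $\sigma(\{[\![\varphi]\!]_{\mathcal{G}}\mid\varphi\text{ a formula}\})$. Frege condition: for all $s,s'\in S$ and $\gamma\in\Gamma$ the set $\mathcal{F}=\{A\in\mathcal{B}(\mathrm{Sub}(S))\mid A\in P_\gamma(s)\Leftrightarrow A\in P_\gamma(s')\}$ is closed under taking $\sigma$-algebras, i.e. $\mathcal{A}\subseteq\mathcal{F}$ implies $\sigma(\mathcal{A})\subseteq\mathcal{F}$. -}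

module Defs where

open import Algebra.Bundles using (CommutativeRing)
import Algebra.Definitions.RawMonoid as RawMonoidDefs
open import Axiom.ExcludedMiddle using (ExcludedMiddle)
open import Data.Bool.Base using (Bool; true; false; not; _∧_; _∨_; T)
open import Data.Empty using (⊥-elim)
open import Data.Fin.Base using (Fin; toℕ)
open import Data.List.Base using (List; applyUpTo)
open import Data.Nat.Base using (ℕ; zero; suc)
open import Data.Nat.Properties using (suc-injective)
open import Data.Product.Base using (Σ; Σ-syntax; ∃; _×_; _,_; proj₁; proj₂)
open import Data.Product.Relation.Binary.Pointwise.NonDependent using (_×ₛ_)
open import Function.Base using (_∘_)
open import Function.Bundles using (Func; _⟨$⟩_; _⇔_; mk⇔; Equivalence)
import Function.Construct.Composition as Composition
open import Level using (0ℓ)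
open import Relation.Binary.Bundles using (Setoid)
open import Relation.Binary.Core using (Rel)
import Relation.Binary.Construct.NonStrictToStrict as ToStrict
open import Relation.Binary.PropositionalEquality as ≡ using (_≡_; _≢_)
open import Relation.Binary.Structures using (IsEquivalence; IsTotalOrder)
open import Relation.Nullary.Decidable.Core using (does; yes; no)
open import Relation.Nullary.Negation.Core using (¬_)
open import Relation.Unary using (Pred)

module Bounds {A : Set} (_≤_ : Rel A 0ℓ) where

  IsSup IsInf : Pred A 0ℓ → Pred A 0ℓ
  IsSup P v = (∀ x → P x → x ≤ v) × (∀ u → (∀ x → P x → x ≤ u) → v ≤ u)
  IsInf P v = (∀ x → P x → v ≤ x) × (∀ u → (∀ x → P x → u ≤ x) → u ≤ v)

-- The reals are axiomatised up to isomorphism as a Dedekind-complete ordered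
-- field; the development is parametrised by one.
record CompleteOrderedField : Set₁ where
  field
    commutativeRing : CommutativeRing 0ℓ 0ℓ
  open CommutativeRing commutativeRing public hiding (_≉_)
  field
    _≤_          : Rel Carrier 0ℓ
    isTotalOrder : IsTotalOrder _≈_ _≤_

  infix 4 _≤_

  open ToStrict _≈_ _≤_ public using (_<_)
  open Bounds _≤_ public

  field
    0<1      : 0# < 1#
    +-monoˡ  : ∀ z {x y} → x ≤ y → (x + z) ≤ (y + z)
    *-nonNeg : ∀ {x y} → 0# ≤ x → 0# ≤ y → 0# ≤ (x * y)
    inverse  : ∀ x → ¬ x ≈ 0# → ∃ λ y → x * y ≈ 1#
    complete : (P : Pred Carrier 0ℓ) → ∃ P →
               (∃ λ b → ∀ x → P x → x ≤ b) → ∃ (IsSup P)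

  module ≤ = IsTotalOrder isTotalOrder

-- Classical logic is a parameter.  It makes Bool-valued predicates on a type
-- the same thing as arbitrary subsets, while keeping power sets small.
module GameLogic (lem : ExcludedMiddle 0ℓ) (ℝ : CompleteOrderedField) where

  module ℝ = CompleteOrderedField ℝ
  open ℝ using (0#; 1#; _≤_; _<_; _+_; _-_; _*_; _≈_; IsSup; IsInf)
  open RawMonoidDefs ℝ.+-rawMonoid using (sum) renaming (_×_ to _·_)

  NonNegRational : Pred ℝ.Carrier 0ℓ
  NonNegRational x = ∃ λ (m : ℕ) → ∃ λ (n : ℕ) → suc n · x ≈ m · 1#

  partialSum : (ℕ → ℝ.Carrier) → ℕ → ℝ.Carrier
  partialSum a n = sum {n} (a ∘ toℕ)

  -- The value of a series of non-negative terms.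
  HasSum : (ℕ → ℝ.Carrier) → Pred ℝ.Carrier 0ℓ
  HasSum a = IsSup (λ x → ∃ λ n → x ≈ partialSum a n)

  𝕀 : Setoid 0ℓ 0ℓ
  𝕀 = record
    { Carrier       = Σ[ x ∈ ℝ.Carrier ] (0# ≤ x × x ≤ 1#)
    ; _≈_           = λ x y → proj₁ x ≈ proj₁ y
    ; isEquivalence = record { refl = ℝ.refl ; sym = ℝ.sym ; trans = ℝ.trans }
    }

  0≤1 : 0# ≤ 1#
  0≤1 = proj₁ ℝ.0<1

  indicator : Bool → Setoid.Carrier 𝕀
  indicator true  = 1# , 0≤1 , ℝ.≤.refl
  indicator false = 0# , ℝ.≤.refl , 0≤1

  ∣_∣ : Setoid 0ℓ 0ℓ → Set
  ∣ X ∣ = Setoid.Carrier X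

  𝒫 : Setoid 0ℓ 0ℓ → Set
  𝒫 X = Func X (≡.setoid Bool)

  infix 4 _∈_ _⊆_ _≐_

  _∈_ : {X : Setoid 0ℓ 0ℓ} → ∣ X ∣ → 𝒫 X → Set
  x ∈ A = T (A ⟨$⟩ x)

  _⊆_ _≐_ : {X : Setoid 0ℓ 0ℓ} → 𝒫 X → 𝒫 X → Set
  A ⊆ B = ∀ x → x ∈ A → x ∈ B
  A ≐ B = ∀ x → A ⟨$⟩ x ≡ B ⟨$⟩ x

  ≐⇒⊆ : {X : Setoid 0ℓ 0ℓ} {A B : 𝒫 X} → A ≐ B → A ⊆ B
  ≐⇒⊆ A≐B x = ≡.subst T (A≐B x)

  ⊆-antisym : {X : Setoid 0ℓ 0ℓ} {A B : 𝒫 X} → A ⊆ B → B ⊆ A → A ≐ B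
  ⊆-antisym {A = A} {B} A⊆B B⊆A x with A ⟨$⟩ x | B ⟨$⟩ x | A⊆B x | B⊆A x
  ... | true  | true  | _ | _ = ≡.refl
  ... | false | false | _ | _ = ≡.refl
  ... | true  | false | f | _ = ⊥-elim (f _)
  ... | false | true  | _ | g = ⊥-elim (g _)

  ∈-resp : {X : Setoid 0ℓ 0ℓ} (A : 𝒫 X) {x y : ∣ X ∣} →
           Setoid._≈_ X x y → x ∈ A → y ∈ A
  ∈-resp A x≈y = ≡.subst T (Func.cong A x≈y)

  ⌊_⌋ : Set → Bool
  ⌊ P ⌋ = does (lem {P})

  ⌊⌋-cong : {P Q : Set} → (P → Q) → (Q → P) → ⌊ P ⌋ ≡ ⌊ Q ⌋
  ⌊⌋-cong {P} {Q} f g with lem {P} | lem {Q}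
  ... | yes _ | yes _  = ≡.refl
  ... | no _  | no _   = ≡.refl
  ... | yes p | no ¬q  = ⊥-elim (¬q (f p))
  ... | no ¬p | yes q  = ⊥-elim (¬p (g q))

  ⌊⌋-intro : {P : Set} → P → T ⌊ P ⌋
  ⌊⌋-intro {P} p with lem {P}
  ... | yes _ = _
  ... | no ¬p = ⊥-elim (¬p p)

  ⌊⌋-elim : {P : Set} → T ⌊ P ⌋ → P
  ⌊⌋-elim {P} t with lem {P}
  ... | yes p = p

  compr : {X : Setoid 0ℓ 0ℓ} (P : Pred ∣ X ∣ 0ℓ) →
          (∀ {x y} → Setoid._≈_ X x y → P x → P y) → 𝒫 X
  compr {X} P resp = record
    { to   = λ x → ⌊ P x ⌋
    ; cong = λ x≈y → ⌊⌋-cong (resp x≈y) (resp (Setoid.sym X x≈y))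
    }

  full ∅ : {X : Setoid 0ℓ 0ℓ} → 𝒫 X
  full = record { to = λ _ → true  ; cong = λ _ → ≡.refl }
  ∅    = record { to = λ _ → false ; cong = λ _ → ≡.refl }

  ∁ : {X : Setoid 0ℓ 0ℓ} → 𝒫 X → 𝒫 X
  ∁ A = record { to = λ x → not (A ⟨$⟩ x) ; cong = ≡.cong not ∘ Func.cong A }

  infixr 7 _∩_
  infixr 6 _∪_

  _∪_ _∩_ : {X : Setoid 0ℓ 0ℓ} → 𝒫 X → 𝒫 X → 𝒫 X
  A ∪ B = record { to   = λ x → (A ⟨$⟩ x) ∨ (B ⟨$⟩ x)
                 ; cong = λ x≈y → ≡.cong₂ _∨_ (Func.cong A x≈y) (Func.cong B x≈y) }
  A ∩ B = record { to   = λ x → (A ⟨$⟩ x) ∧ (B ⟨$⟩ x)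
                 ; cong = λ x≈y → ≡.cong₂ _∧_ (Func.cong A x≈y) (Func.cong B x≈y) }

  ⋃ ⋂ : {X : Setoid 0ℓ 0ℓ} {I : Set} → (I → 𝒫 X) → 𝒫 X
  ⋃ A = compr (λ x → ∃ λ i → x ∈ A i) (λ { x≈y (i , x∈A) → i , ∈-resp (A i) x≈y x∈A })
  ⋂ A = compr (λ x → ∀ i → x ∈ A i) (λ x≈y x∈A i → ∈-resp (A i) x≈y (x∈A i))

  infix 8 _⁻¹[_]

  _⁻¹[_] : {X Y : Setoid 0ℓ 0ℓ} → Func X Y → 𝒫 Y → 𝒫 X
  f ⁻¹[ B ] = Composition.function f B

  image : {X Y : Setoid 0ℓ 0ℓ} → Func X Y → 𝒫 X → 𝒫 Y
  image {X} {Y} f A = compr (λ y → ∃ λ x → x ∈ A × Setoid._≈_ Y (f ⟨$⟩ x) y)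
    (λ { y≈y′ (x , x∈A , fx≈y) → x , x∈A , Setoid.trans Y fx≈y y≈y′ })

  rectangle : {X Y : Setoid 0ℓ 0ℓ} → 𝒫 X → 𝒫 Y → 𝒫 (X ×ₛ Y)
  rectangle A B = record
    { to   = λ { (x , y) → (A ⟨$⟩ x) ∧ (B ⟨$⟩ y) }
    ; cong = λ { (x≈x′ , y≈y′) → ≡.cong₂ _∧_ (Func.cong A x≈x′) (Func.cong B y≈y′) }
    }

  section : {X Y : Setoid 0ℓ 0ℓ} → 𝒫 (X ×ₛ Y) → ∣ Y ∣ → 𝒫 X
  section {Y = Y} H y = record
    { to   = λ x → H ⟨$⟩ (x , y)
    ; cong = λ x≈x′ → Func.cong H (x≈x′ , Setoid.refl Y)
    }

  record IsSigmaAlgebra {X : Setoid 0ℓ 0ℓ} (𝒜 : Pred (𝒫 X) 0ℓ) : Set where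
    field
      resp     : ∀ {A B} → A ≐ B → 𝒜 A → 𝒜 B
      full∈    : 𝒜 full
      ∁-closed : ∀ {A} → 𝒜 A → 𝒜 (∁ A)
      ⋃-closed : (A : ℕ → 𝒫 X) → (∀ n → 𝒜 (A n)) → 𝒜 (⋃ A)

  data σ {X : Setoid 0ℓ 0ℓ} (𝒜 : Pred (𝒫 X) 0ℓ) : Pred (𝒫 X) 0ℓ where
    gen      : ∀ {A} → 𝒜 A → σ 𝒜 A
    resp     : ∀ {A B} → A ≐ B → σ 𝒜 A → σ 𝒜 B
    full∈    : σ 𝒜 full
    ∁-closed : ∀ {A} → σ 𝒜 A → σ 𝒜 (∁ A)
    ⋃-closed : (A : ℕ → 𝒫 X) → (∀ n → σ 𝒜 (A n)) → σ 𝒜 (⋃ A)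

  record MeasurableSpace : Set₁ where
    field
      setoid         : Setoid 0ℓ 0ℓ
      Measurable     : Pred (𝒫 setoid) 0ℓ
      isSigmaAlgebra : IsSigmaAlgebra Measurable
    open Setoid setoid public
    open IsSigmaAlgebra isSigmaAlgebra public

  open MeasurableSpace using (setoid; Measurable)

  generatedBy : {X : Setoid 0ℓ 0ℓ} → Pred (𝒫 X) 0ℓ → MeasurableSpace
  generatedBy {X} 𝒜 = record
    { setoid         = X
    ; Measurable     = σ 𝒜
    ; isSigmaAlgebra = record
        { resp = resp ; full∈ = full∈ ; ∁-closed = ∁-closed ; ⋃-closed = ⋃-closed }
    }

  IsMeasurable : (S T : MeasurableSpace) → Func (setoid S) (setoid T) → Set
  IsMeasurable S T f = ∀ B → Measurable T B → Measurable S (f ⁻¹[ B ])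

  infixr 2 _⊗_

  _⊗_ : MeasurableSpace → MeasurableSpace → MeasurableSpace
  S ⊗ T = generatedBy λ E →
    ∃ λ A → ∃ λ B → Measurable S A × Measurable T B × E ≐ rectangle A B

  Open : Pred (𝒫 𝕀) 0ℓ
  Open U = ∀ x → x ∈ U → ∃ λ ε → 0# < ε ×
    (∀ y → proj₁ x < proj₁ y + ε → proj₁ y < proj₁ x + ε → y ∈ U)

  [0,1] : MeasurableSpace
  [0,1] = generatedBy Open

  Interval : Pred (𝒫 𝕀) 0ℓ
  Interval I = ∀ x y z → x ∈ I → z ∈ I → proj₁ x ≤ proj₁ y → proj₁ y ≤ proj₁ z → y ∈ I

  SouslinClosed : MeasurableSpace → Set
  SouslinClosed S = (A : List ℕ → 𝒫 (setoid S)) → (∀ v → Measurable S (A v)) →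
    Measurable S (⋃ λ (α : ℕ → ℕ) → ⋂ λ (n : ℕ) → A (applyUpTo α n))

  record IntervalCover (E : 𝒫 𝕀) : Set where
    field
      lo hi  : ℕ → ℝ.Carrier
      lo≤hi  : ∀ n → lo n ≤ hi n
      covers : ∀ x → x ∈ E → ∃ λ n → lo n ≤ proj₁ x × proj₁ x ≤ hi n

  -- Lebesgue outer measure, applied to Borel sets only.
  IsLebesgueMeasure : 𝒫 𝕀 → Pred ℝ.Carrier 0ℓ
  IsLebesgueMeasure E = IsInf λ x → Σ[ c ∈ IntervalCover E ]
    HasSum (λ n → IntervalCover.hi c n - IntervalCover.lo c n) x

  record SimpleFunctionBelow (f : ∣ 𝕀 ∣ → ℝ.Carrier) : Set where
    field
      size       : ℕ
      coeff      : Fin size → ℝ.Carrier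
      coeff≥0    : ∀ i → 0# ≤ coeff i
      piece      : Fin size → 𝒫 𝕀
      measurable : ∀ i → Measurable [0,1] (piece i)
      length     : Fin size → ℝ.Carrier
      isLength   : ∀ i → IsLebesgueMeasure (piece i) (length i)
      below      : ∀ x → sum (λ i → coeff i * proj₁ (indicator (piece i ⟨$⟩ x))) ≤ f x

    integral : ℝ.Carrier
    integral = sum (λ i → coeff i * length i)

  -- The Lebesgue integral ∫₀¹ f(r) dr of a non-negative Borel function.  It is
  -- used below for r ↦ μ(𝔍(τ|A,r)), which is monotone in r, hence Borel.
  IsIntegral : (∣ 𝕀 ∣ → ℝ.Carrier) → Pred ℝ.Carrier 0ℓ
  IsIntegral f = IsSup λ x → Σ[ s ∈ SimpleFunctionBelow f ] x ≈ SimpleFunctionBelow.integral s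

  SimpleFunctionBelow-mono : ∀ {f g} → (∀ x → f x ≤ g x) →
    SimpleFunctionBelow f → SimpleFunctionBelow g
  SimpleFunctionBelow-mono f≤g s = record
    { size = size ; coeff = coeff ; coeff≥0 = coeff≥0 ; piece = piece
    ; measurable = measurable ; length = length ; isLength = isLength
    ; below = λ x → ℝ.≤.trans (below x) (f≤g x) }
    where open SimpleFunctionBelow s

  IsIntegral-cong : ∀ {f g} → (∀ x → f x ≈ g x) → ∀ {v} → IsIntegral f v → IsIntegral g v
  IsIntegral-cong {f} {g} f≈g (upper , least) =
    (λ { x (s , x≈) → upper x (SimpleFunctionBelow-mono g≤f s , x≈) }) ,
    (λ u h → least u λ { x (s , x≈) → h x (SimpleFunctionBelow-mono f≤g s , x≈) })
    where
    f≤g : ∀ x → f x ≤ g x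
    f≤g x = ℝ.≤.reflexive (f≈g x)
    g≤f : ∀ x → g x ≤ f x
    g≤f x = ℝ.≤.reflexive (ℝ.sym (f≈g x))

  record Measure (S : MeasurableSpace) : Set where
    private module S = MeasurableSpace S
    field
      -- The bound μ(S) ≤ 1 is part of the codomain.
      value      : (A : 𝒫 S.setoid) → S.Measurable A → ∣ 𝕀 ∣
      value-cong : ∀ {A B} (a : S.Measurable A) (b : S.Measurable B) →
                   A ≐ B → proj₁ (value A a) ≈ proj₁ (value B b)
      value-∅    : ∀ m → proj₁ (value ∅ m) ≈ 0#
      σ-additive : (A : ℕ → 𝒫 S.setoid) (m : ∀ n → S.Measurable (A n)) →
                   (∀ i j → i ≢ j → ∀ x → x ∈ A i → ¬ x ∈ A j) →
                   HasSum (λ n → proj₁ (value (A n) (m n)))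
                          (proj₁ (value (⋃ A) (S.⋃-closed A m)))

  open Measure using (value)

  Subₛ : MeasurableSpace → Setoid 0ℓ 0ℓ
  Subₛ S = record
    { Carrier       = Measure S
    ; _≈_           = λ μ ν → ∀ A m → proj₁ (value μ A m) ≈ proj₁ (value ν A m)
    ; isEquivalence = record
        { refl  = λ _ _ → ℝ.refl
        ; sym   = λ p A m → ℝ.sym (p A m)
        ; trans = λ p q A m → ℝ.trans (p A m) (q A m)
        }
    }

  evaluation : (S : MeasurableSpace) (A : 𝒫 (setoid S)) → Measurable S A → Func (Subₛ S) 𝕀
  evaluation S A m = record { to = λ μ → value μ A m ; cong = λ μ≈ν → μ≈ν A m }

  Sub : MeasurableSpace → MeasurableSpace
  Sub S = generatedBy {Subₛ S} λ E →
    ∃ λ A → Σ[ m ∈ Measurable S A ] ∃ λ B → Measurable [0,1] B × E ≐ evaluation S A m ⁻¹[ B ]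

  Sub-map : (S T : MeasurableSpace) (f : Func (setoid S) (setoid T)) →
            IsMeasurable S T f → Func (Subₛ S) (Subₛ T)
  Sub-map S T f f-meas = record
    { to = λ μ → record
        { value      = λ B m → value μ (f ⁻¹[ B ]) (f-meas B m)
        ; value-cong = λ a b A≐B →
            Measure.value-cong μ (f-meas _ a) (f-meas _ b) (A≐B ∘ (f ⟨$⟩_))
        ; value-∅    = λ m → ℝ.trans
            (Measure.value-cong μ (f-meas _ m) ∅∈ (λ _ → ≡.refl)) (Measure.value-∅ μ ∅∈)
        ; σ-additive = λ A m disj → HasSum-cong (λ n → proj₁ (value μ (f ⁻¹[ A n ]) (f-meas (A n) (m n))))
            (Measure.value-cong μ (⋃∈ A m) (f-meas _ (T.⋃-closed A m)) (λ _ → ≡.refl))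
            (Measure.σ-additive μ (λ n → f ⁻¹[ A n ]) (λ n → f-meas (A n) (m n))
              (λ i j i≢j x → disj i j i≢j (f ⟨$⟩ x)))
        }
    ; cong = λ μ≈ν B m → μ≈ν (f ⁻¹[ B ]) (f-meas B m)
    }
    where
    module S = MeasurableSpace S
    module T = MeasurableSpace T
    ∅∈ : S.Measurable ∅
    ∅∈ = S.resp (λ _ → ≡.refl) (S.∁-closed S.full∈)
    ⋃∈ : (A : ℕ → 𝒫 T.setoid) (m : ∀ n → T.Measurable (A n)) →
         S.Measurable (⋃ λ n → f ⁻¹[ A n ])
    ⋃∈ A m = S.⋃-closed _ (λ n → f-meas (A n) (m n))
    HasSum-cong : ∀ a {v w} → v ≈ w → HasSum a v → HasSum a w
    HasSum-cong a v≈w (upper , least) =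
      (λ x p → ℝ.≤.trans (upper x p) (ℝ.≤.reflexive v≈w)) ,
      (λ u h → ℝ.≤.trans (ℝ.≤.reflexive (ℝ.sym v≈w)) (least u h))

  module _ where
    private
      𝟙 : Bool → ℝ.Carrier
      𝟙 b = proj₁ (indicator b)

      Disjoint : (ℕ → Bool) → Set
      Disjoint b = ∀ i j → i ≢ j → T (b i) → ¬ T (b j)

      tail-disjoint : ∀ {b} → Disjoint b → Disjoint (b ∘ suc)
      tail-disjoint d i j i≢j = d (suc i) (suc j) (i≢j ∘ suc-injective)

      sum-zero : ∀ b → (∀ i → ¬ T (b i)) → ∀ n → partialSum (𝟙 ∘ b) n ≈ 0#
      sum-zero b none zero    = ℝ.refl
      sum-zero b none (suc n) with b 0 | none 0
      ... | true  | ¬t = ⊥-elim (¬t _)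
      ... | false | _  = ℝ.trans (ℝ.+-identityˡ _) (sum-zero (b ∘ suc) (none ∘ suc) n)

      sum-bound : ∀ b → Disjoint b → ∀ n → partialSum (𝟙 ∘ b) n ≤ 1#
      sum-bound b d zero    = 0≤1
      sum-bound b d (suc n) with b 0 | d 0
      ... | false | _  = ℝ.≤.trans (ℝ.≤.reflexive (ℝ.+-identityˡ _))
                           (sum-bound (b ∘ suc) (tail-disjoint d) n)
      ... | true  | d₀ = ℝ.≤.reflexive (ℝ.trans
                           (ℝ.+-congˡ (sum-zero (b ∘ suc) (λ i → d₀ (suc i) (λ ()) _) n))
                           (ℝ.+-identityʳ _))

      sum-attains : ∀ b → Disjoint b → ∀ k → T (b k) → partialSum (𝟙 ∘ b) (suc k) ≈ 1#
      sum-attains b d zero    t with b 0 | t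
      ... | true | _ = ℝ.+-identityʳ _
      sum-attains b d (suc k) t with b 0 | d 0 (suc k) (λ ())
      ... | true  | d₀ = ⊥-elim (d₀ _ t)
      ... | false | _  = ℝ.trans (ℝ.+-identityˡ _)
                           (sum-attains (b ∘ suc) (tail-disjoint d) k t)

      indicator-sum : ∀ b → Disjoint b → HasSum (𝟙 ∘ b) (𝟙 ⌊ (∃ λ n → T (b n)) ⌋)
      indicator-sum b d with lem {∃ λ n → T (b n)}
      ... | yes (k , t) =
        (λ { x (n , x≈) → ℝ.≤.trans (ℝ.≤.reflexive x≈) (sum-bound b d n) }) ,
        (λ u h → h 1# (suc k , ℝ.sym (sum-attains b d k t)))
      ... | no ¬∃ =
        (λ { x (n , x≈) → ℝ.≤.reflexive (ℝ.trans x≈ (sum-zero b (λ i t → ¬∃ (i , t)) n)) }) ,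
        (λ u h → h 0# (0 , ℝ.refl))

    δ : (S : MeasurableSpace) → ∣ setoid S ∣ → Measure S
    δ S s = record
      { value      = λ A _ → indicator (A ⟨$⟩ s)
      ; value-cong = λ _ _ A≐B → ℝ.reflexive (≡.cong 𝟙 (A≐B s))
      ; value-∅    = λ _ → ℝ.refl
      ; σ-additive = λ A m disj →
          indicator-sum (λ n → A n ⟨$⟩ s) (λ i j i≢j → disj i j i≢j s)
      }

  β : (S : MeasurableSpace) (A : 𝒫 (setoid S)) → Measurable S A → ℝ.Carrier → 𝒫 (Subₛ S)
  β S A m q = compr (λ μ → q < proj₁ (value μ A m))
    (λ μ≈ν → <-respʳ (μ≈ν A m))
    where
    <-respʳ : ∀ {x y z} → x ≈ y → z < x → z < y
    <-respʳ x≈y (z≤x , z≉x) =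
      ℝ.≤.trans z≤x (ℝ.≤.reflexive x≈y) , λ z≈y → z≉x (ℝ.trans z≈y (ℝ.sym x≈y))

  record 𝒱 (S : MeasurableSpace) : Set₁ where
    field
      Member      : Pred (𝒫 (Subₛ S)) 0ℓ
      measurable  : ∀ {W} → Member W → Measurable (Sub S) W
      upwardClosed : ∀ {W W′} → Member W → Measurable (Sub S) W′ → W ⊆ W′ → Member W′

    Member-resp : ∀ {W W′} → W ≐ W′ → Member W → Member W′
    Member-resp {W} {W′} W≐W′ w =
      upwardClosed w (resp W≐W′ (measurable w)) (≐⇒⊆ {A = W} {W′} W≐W′)

  open 𝒱 using (Member; Member-resp)

  record StochasticEffectivity (S : MeasurableSpace) : Set₁ where
    private module S = MeasurableSpace S
    field
      at      : S.Carrier → 𝒱 S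
      at-resp : ∀ {s s′} → s S.≈ s′ → ∀ {W} → Member (at s) W → Member (at s′) W

    hits : 𝒫 (Subₛ S ×ₛ 𝕀) → 𝒫 (S.setoid ×ₛ 𝕀)
    hits H = compr (λ { (s , q) → Member (at s) (section {Y = 𝕀} H q) })
      (λ { {s , q} {s′ , q′} (s≈s′ , q≈q′) w → Member-resp (at s′)
             (λ μ → Func.cong H {μ , q} {μ , q′} (Setoid.refl (Subₛ S) {μ} , q≈q′))
             (at-resp s≈s′ w) })

    field
      t-measurable : ∀ H → Measurable (Sub S ⊗ [0,1]) H → Measurable (S ⊗ [0,1]) (hits H)

  open StochasticEffectivity using (at; at-resp)

  record IsMorphism {S T : MeasurableSpace} (P : StochasticEffectivity S)
                    (Q : StochasticEffectivity T) (f : Func (setoid S) (setoid T)) : Set where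
    field
      measurable : IsMeasurable S T f
      preserves  : ∀ s W → Measurable (Sub T) W →
        Member (at Q (f ⟨$⟩ s)) W ⇔ Member (at P s) (Sub-map S T f measurable ⁻¹[ W ])

  record Equivalenceₛ (X : Setoid 0ℓ 0ℓ) : Set₁ where
    private module X = Setoid X
    field
      Related       : Rel X.Carrier 0ℓ
      isEquivalence : IsEquivalence Related
      reflexive     : ∀ {x y} → x X.≈ y → Related x y

  open Equivalenceₛ using (Related)

  -- The set of ρ-classes, as the carrier of X with ρ as its equality.
  quotientₛ : (X : Setoid 0ℓ 0ℓ) → Equivalenceₛ X → Setoid 0ℓ 0ℓ
  quotientₛ X ρ = record { isEquivalence = Equivalenceₛ.isEquivalence ρ }

  ηₛ : {X : Setoid 0ℓ 0ℓ} (ρ : Equivalenceₛ X) → Func X (quotientₛ X ρ)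
  ηₛ ρ = record { to = λ x → x ; cong = Equivalenceₛ.reflexive ρ }

  -- B ⊆ S/ρ is measurable iff its inverse image under the factor map is: the
  -- largest σ-algebra making the factor map measurable.
  _/_ : (S : MeasurableSpace) → Equivalenceₛ (setoid S) → MeasurableSpace
  S / ρ = record
    { setoid         = quotientₛ (setoid S) ρ
    ; Measurable     = λ B → S.Measurable (ηₛ ρ ⁻¹[ B ])
    ; isSigmaAlgebra = record
        { resp     = S.resp
        ; full∈    = S.resp (λ _ → ≡.refl) S.full∈
        ; ∁-closed = λ m → S.resp (λ _ → ≡.refl) (S.∁-closed m)
        ; ⋃-closed = λ A m → S.resp (λ _ → ≡.refl) (S.⋃-closed (λ n → ηₛ ρ ⁻¹[ A n ]) m)
        }
    }
    where module S = MeasurableSpace S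

  η-measurable : (S : MeasurableSpace) (ρ : Equivalenceₛ (setoid S)) →
                 IsMeasurable S (S / ρ) (ηₛ ρ)
  η-measurable S ρ B m = m

  Invariant : (S : MeasurableSpace) → Equivalenceₛ (setoid S) → Pred (𝒫 (setoid S)) 0ℓ
  Invariant S ρ A = Measurable S A × (∀ s s′ → Related ρ s s′ → s ∈ A → s′ ∈ A)

  ExactWith : (S : MeasurableSpace) → Equivalenceₛ (setoid S) → Pred (𝒫 (setoid S)) 0ℓ → Set
  ExactWith S ρ 𝒜 =
    (∀ A → 𝒜 A → Measurable S A) × (∀ B → Invariant S ρ B ⇔ σ 𝒜 B)

  infix 3 _×Δ

  _×Δ : {X : Setoid 0ℓ 0ℓ} → Equivalenceₛ X → Equivalenceₛ (X ×ₛ 𝕀)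
  ρ ×Δ = record
    { Related       = λ { (s , q) (s′ , q′) → Related ρ s s′ × Setoid._≈_ 𝕀 q q′ }
    ; isEquivalence = record
        { refl  = IsEquivalence.refl ρ-eq , ℝ.refl
        ; sym   = λ { (p , q) → IsEquivalence.sym ρ-eq p , ℝ.sym q }
        ; trans = λ { (p , q) (p′ , q′) → IsEquivalence.trans ρ-eq p p′ , ℝ.trans q q′ }
        }
    ; reflexive     = λ { (p , q) → Equivalenceₛ.reflexive ρ p , q }
    }
    where ρ-eq = Equivalenceₛ.isEquivalence ρ

  Tame : (S : MeasurableSpace) → Equivalenceₛ (setoid S) → Set₁
  Tame S ρ = Σ[ 𝒜 ∈ Pred (𝒫 (setoid S)) 0ℓ ]
    ExactWith S ρ 𝒜 ×
    ExactWith (S ⊗ [0,1]) (ρ ×Δ)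
      (λ E → ∃ λ A → ∃ λ I → 𝒜 A × Interval I × E ≐ rectangle A I)

  IsCongruenceFor : {S : MeasurableSpace} → Equivalenceₛ (setoid S) →
                    StochasticEffectivity S → Set₁
  IsCongruenceFor {S} ρ P = Σ[ Pρ ∈ StochasticEffectivity (S / ρ) ] IsMorphism P Pρ (ηₛ ρ)

  data Game (Γ : Set) : Set where
    prim        : Γ → Game Γ
    _ᵈ _* _ˣ    : Game Γ → Game Γ
    _∪ᵍ_ _∩ᵍ_ _⨾_ : Game Γ → Game Γ → Game Γ

  record GameFrame (Γ : Set) (ε : Γ) : Set₁ where
    field
      space : MeasurableSpace
      P     : Γ → StochasticEffectivity space
      P-ε   : ∀ s W → Measurable (Sub space) W →
              Member (at (P ε) s) W ⇔ (δ space s ∈ W)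

  module Interpretation {Γ : Set} {ε : Γ} (𝓕 : GameFrame Γ ε) where
    open GameFrame 𝓕
    private
      module S = MeasurableSpace space
      X = S.setoid

    -- Maps (A , q) ↦ 𝔍(τ | A , q).  Only measurable A and q ≥ 0 matter.
    Transformer : Set
    Transformer = 𝒫 X → ℝ.Carrier → 𝒫 X

    basic : Γ → Transformer
    basic γ A q = compr (λ s → Σ[ m ∈ S.Measurable A ] Member (at (P γ) s) (β space A m q))
      (λ { s≈s′ (m , w) → m , at-resp (P γ) s≈s′ w })

    dual : Transformer → Transformer
    dual K A q = ∁ (K (∁ A) q)

    -- The index ranges over Q⁽²⁾(q).
    choice : Transformer → Transformer → Transformer
    choice K L A q = ⋂ {I = Σ[ a ∈ ℝ.Carrier × ℝ.Carrier ]
        (NonNegRational (proj₁ a) × NonNegRational (proj₂ a) × proj₁ a + proj₂ a ≤ q)}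
      λ { ((a₁ , a₂) , _) → K A a₁ ∪ L A a₂ }

    -- The set G_τ(A,q), where K interprets τ.  The integrand must be defined,
    -- i.e. each K A r measurable.
    G : (K : Transformer) (A : 𝒫 X) → (∀ (r : ∣ 𝕀 ∣) → S.Measurable (K A (proj₁ r))) →
        ℝ.Carrier → 𝒫 (Subₛ space)
    G K A m q = compr
      (λ μ → ∃ λ v → IsIntegral (λ r → proj₁ (value μ (K A (proj₁ r)) (m r))) v × q < v)
      (λ { μ≈ν (v , int , q<v) → v , IsIntegral-cong (λ r → μ≈ν (K A (proj₁ r)) (m r)) int , q<v })

    -- 𝔍(γ;τ | A , q).  As in basic, the measurability condition only makes the
    -- expression meaningful; over a space closed under the Souslin operation it
    -- holds for every measurable A and every K interpreting a game.
    after : Γ → Transformer → Transformer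
    after γ K A q = compr
      (λ s → Σ[ m ∈ (∀ (r : ∣ 𝕀 ∣) → S.Measurable (K A (proj₁ r))) ]
               Member (at (P γ) s) (G K A m q))
      (λ { s≈s′ (m , w) → m , at-resp (P γ) s≈s′ w })

    iterate : ℕ → (Transformer → Transformer) → Transformer → Transformer
    iterate zero    F K = K
    iterate (suc n) F K = F (iterate n F K)

    -- 𝔍(τ*;τ₀ | A , q), where F K interprets τ;κ whenever K interprets κ
    -- and K₀ interprets τ₀; the index ranges over Q⁽∞⁾(q).
    star : (Transformer → Transformer) → Transformer → Transformer
    star F K₀ A q = ⋂ {I = Σ[ a ∈ (ℕ → ℝ.Carrier) ]
        ((∀ n → NonNegRational (a n)) × (∀ n → partialSum a n ≤ q))}
      λ { (a , _) → ⋃ λ (n : ℕ) → iterate n F K₀ A (a n) }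

    -- The recursion is on the first component of a composition:  seq τ K
    -- interprets τ;κ, where K interprets κ.  The clauses for ᵈ, ∩ and ˣ are
    -- obtained by rewriting with the identifications
    --   τᵈ;κ = (τ;κᵈ)ᵈ,   (τ₁∩τ₂);κ = (τ₁ᵈ;κᵈ ∪ τ₂ᵈ;κᵈ)ᵈ = ((τ₁;κ)ᵈ ∪ (τ₂;κ)ᵈ)ᵈ,
    --   τˣ;κ = ((τᵈ)*;κᵈ)ᵈ.
    -- The other identifications hold up to ≐ by construction.
    seq : Game Γ → Transformer → Transformer
    seq (prim γ)   K = after γ K
    seq (τ ᵈ)      K = dual (seq τ (dual K))
    seq (τ₁ ∪ᵍ τ₂) K = choice (seq τ₁ K) (seq τ₂ K)
    seq (τ₁ ∩ᵍ τ₂) K = dual (choice (dual (seq τ₁ K)) (dual (seq τ₂ K)))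
    seq (τ₁ ⨾ τ₂)  K = seq τ₁ (seq τ₂ K)
    seq (τ *)      K = star (seq τ) K
    seq (τ ˣ)      K = dual (star (λ L → dual (seq τ (dual L))) (dual K))

    -- τˣ = ((τᵈ)*)ᵈ, and a bare (τᵈ)* is read as (τᵈ)*;ε.
    𝔍 : Game Γ → Transformer
    𝔍 (prim γ)   = basic γ
    𝔍 (τ ᵈ)      = dual (𝔍 τ)
    𝔍 (τ₁ ∪ᵍ τ₂) = choice (𝔍 τ₁) (𝔍 τ₂)
    𝔍 (τ₁ ∩ᵍ τ₂) = dual (choice (dual (𝔍 τ₁)) (dual (𝔍 τ₂)))
    𝔍 (τ₁ ⨾ τ₂)  = seq τ₁ (𝔍 τ₂)
    𝔍 (τ *)      = star (seq τ) (basic ε)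
    𝔍 (τ ˣ)      = dual (star (λ L → dual (seq τ (dual L))) (basic ε))

  data Formula (Γ Ψ : Set) : Set where
    ⊤ᶠ      : Formula Γ Ψ
    atom    : Ψ → Formula Γ Ψ
    _∧ᶠ_    : Formula Γ Ψ → Formula Γ Ψ → Formula Γ Ψ
    ⟨_⟩[_]_ : Game Γ → ∣ 𝕀 ∣ → Formula Γ Ψ → Formula Γ Ψ

  record GameModel (Γ : Set) (ε : Γ) (Ψ : Set) : Set₁ where
    field
      frame : GameFrame Γ ε
    open GameFrame frame public
    field
      V            : Ψ → 𝒫 (setoid space)
      V-measurable : ∀ p → Measurable space (V p)

  open GameModel using (frame; space; P; V)

  record IsModelMorphism {Γ : Set} {ε : Γ} {Ψ : Set} (𝒢 ℋ : GameModel Γ ε Ψ)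
                         (f : Func (setoid (space 𝒢)) (setoid (space ℋ))) : Set where
    field
      measurable : IsMeasurable (space 𝒢) (space ℋ) f
      morphism   : ∀ γ → IsMorphism (P 𝒢 γ) (P ℋ γ) f
      valuation  : ∀ p → f ⁻¹[ V ℋ p ] ≐ V 𝒢 p

  module _ {Γ : Set} {ε : Γ} {Ψ : Set} (𝒢 : GameModel Γ ε Ψ) where
    private
      module 𝒢 = GameModel 𝒢
      S = 𝒢.space

    ⟦_⟧ : Formula Γ Ψ → 𝒫 (setoid S)
    ⟦ ⊤ᶠ ⟧           = full
    ⟦ atom p ⟧       = 𝒢.V p
    ⟦ φ ∧ᶠ ψ ⟧       = ⟦ φ ⟧ ∩ ⟦ ψ ⟧
    ⟦ ⟨ τ ⟩[ q ] φ ⟧ = Interpretation.𝔍 𝒢.frame τ ⟦ φ ⟧ (proj₁ q)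

    infix 4 _⊨_

    _⊨_ : ∣ setoid S ∣ → Formula Γ Ψ → Set
    s ⊨ φ = s ∈ ⟦ φ ⟧

    logicalEquivalence : Equivalenceₛ (setoid S)
    logicalEquivalence = record
      { Related       = λ s s′ → ∀ φ → (s ⊨ φ) ⇔ (s′ ⊨ φ)
      ; isEquivalence = record
          { refl  = λ φ → mk⇔ (λ x → x) (λ x → x)
          ; sym   = λ p φ → mk⇔ (Equivalence.from (p φ)) (Equivalence.to (p φ))
          ; trans = λ p q φ → mk⇔ (Equivalence.to (q φ) ∘ Equivalence.to (p φ))
                                  (Equivalence.from (p φ) ∘ Equivalence.from (q φ))
          }
      ; reflexive     = λ s≈s′ φ → mk⇔ (∈-resp ⟦ φ ⟧ s≈s′)
                                       (∈-resp ⟦ φ ⟧ (Setoid.sym (setoid S) s≈s′))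
      }

    Small : Set₁
    Small = Tame S logicalEquivalence ×
            ExactWith S logicalEquivalence (σ (λ A → ∃ λ φ → A ≐ ⟦ φ ⟧))

    Frege : Set₁
    Frege = ∀ s s′ γ →
      let 𝓕 : Pred (𝒫 (Subₛ S)) 0ℓ
          𝓕 A = Measurable (Sub S) A × (Member (at (𝒢.P γ) s) A ⇔ Member (at (𝒢.P γ) s′) A)
      in (𝒜 : Pred (𝒫 (Subₛ S)) 0ℓ) → (∀ A → 𝒜 A → 𝓕 A) → ∀ A → σ 𝒜 A → 𝓕 A

    record IsCongruence (ρ : Equivalenceₛ (setoid S)) : Set₁ where
      field
        invariant  : ∀ p → Invariant S ρ (𝒢.V p)
        congruence : ∀ γ → IsCongruenceFor ρ (𝒢.P γ)

    factorModel : (ρ : Equivalenceₛ (setoid S)) → IsCongruence ρ → GameModel Γ ε Ψ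
    factorModel ρ c = record
      { frame = record
          { space = S / ρ
          ; P     = λ γ → proj₁ (congruence γ)
          ; P-ε   = λ s W W∈ →
              let open IsMorphism (proj₂ (congruence ε))
                  W′  = Sub-map S (S / ρ) (ηₛ ρ) measurable ⁻¹[ W ]
                  hit = preserves s W W∈
                  unit : (W′∈ : Measurable (Sub S) W′) → Member (at (𝒢.P ε) s) W′ ⇔ (δ S s ∈ W′)
                  unit = 𝒢.P-ε s W′
                  image-δ : Setoid._≈_ (Subₛ (S / ρ))
                    (Sub-map S (S / ρ) (ηₛ ρ) measurable ⟨$⟩ δ S s) (δ (S / ρ) s)
                  image-δ _ _ = ℝ.refl
                  W′∈ = Sub-map-measurable (S / ρ) (ηₛ ρ) measurable W W∈
              in mk⇔
                (λ w → ∈-resp W image-δ (Equivalence.to (unit W′∈) (Equivalence.to hit w)))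
                (λ δ∈W → Equivalence.from hit (Equivalence.from (unit W′∈)
                  (∈-resp W (λ _ _ → ℝ.refl) δ∈W)))
          }
      ; V            = λ p → image (ηₛ ρ) (𝒢.V p)
      ; V-measurable = λ p → MeasurableSpace.resp S
          (⊆-antisym {A = 𝒢.V p} {B = ηₛ ρ ⁻¹[ image (ηₛ ρ) (𝒢.V p) ]}
            (λ s s∈V → ⌊⌋-intro (s , s∈V , IsEquivalence.refl (Equivalenceₛ.isEquivalence ρ)))
            (λ s s∈η → let (s₀ , s₀∈V , s₀ρs) = ⌊⌋-elim s∈η
                       in proj₂ (invariant p) s₀ s s₀ρs s₀∈V))
          (proj₁ (invariant p))
      }
      where
      open IsCongruence c
      Sub-map-measurable : (T : MeasurableSpace) (f : Func (setoid S) (setoid T))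
        (m : IsMeasurable S T f) → IsMeasurable (Sub S) (Sub T) (Sub-map S T f m)
      Sub-map-measurable T f m W (gen (A , A∈ , B , B∈ , W≐)) =
        gen (f ⁻¹[ A ] , m A A∈ , B , B∈ , λ μ → W≐ _)
      Sub-map-measurable T f m W (resp {A} A≐B A∈) =
        resp (λ μ → A≐B _) (Sub-map-measurable T f m A A∈)
      Sub-map-measurable T f m _ full∈ = resp (λ _ → ≡.refl) full∈
      Sub-map-measurable T f m _ (∁-closed {A} A∈) =
        resp (λ _ → ≡.refl) (∁-closed (Sub-map-measurable T f m A A∈))
      Sub-map-measurable T f m _ (⋃-closed A A∈) =
        resp (λ _ → ≡.refl) (⋃-closed _ (λ n → Sub-map-measurable T f m (A n) (A∈ n)))

{-# OPTIONS --safe #-}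

-- Two logically equivalent states agree on every β(⟦φ⟧ , > q), because membership of that
-- set in P γ s is expressed by the formula ⟨γ⟩_q φ.  By the Frege condition they agree on
-- the σ-algebra generated by these sets.  Formulas are closed under ∧, so by Dynkin's π-λ
-- theorem the evaluations μ ↦ μ(A) at all A in σ({⟦φ⟧}), that is, at all ρ-invariant A,
-- are measurable for that σ-algebra, which therefore contains the preimages of all
-- measurable subsets of Sub(S/ρ).  Hence W ↦ Sub(η)⁻¹[W] ∈ P γ s depends on the class of s
-- only.  Tameness gives t-measurability: a (ρ×Δ)-invariant measurable set is generated
-- by rectangles A × I with A invariant, and these come from (S/ρ) ⊗ [0,1].

module Submission where

open import Defs
import Algebra.Properties.Group as GroupProperties
open import Axiom.ExcludedMiddle using (ExcludedMiddle)
open import Data.Bool.Base using (true; false; not; _∧_; _∨_; T)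
open import Data.Bool.Properties using (T-∧; T-∨; ∧-comm; ∧-identityʳ; ∧-zeroʳ)
open import Data.Empty using (⊥-elim)
open import Data.Nat.Base as ℕ using (ℕ; zero; suc)
open import Data.Nat.Properties using (<-cmp; <⇒<′)
open import Data.Product.Base using (Σ-syntax; ∃; _×_; _,_; proj₁; proj₂; uncurry)
open import Data.Product.Relation.Binary.Pointwise.NonDependent using (_×ₛ_)
open import Data.Sum.Base using (_⊎_; inj₁; inj₂)
open import Function.Base using (_∘_; id)
open import Function.Bundles using (Func; _⟨$⟩_; _⇔_; mk⇔; Equivalence)
open import Level using (0ℓ)
open import Relation.Binary.Bundles using (Poset; Setoid)
import Relation.Binary.Construct.NonStrictToStrict as ToStrict
open import Relation.Binary.Definitions using (tri<; tri≈; tri>)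
open import Relation.Binary.PropositionalEquality as ≡ using (_≡_; _≢_)
import Relation.Binary.Reasoning.PartialOrder as PartialOrderReasoning
open import Relation.Binary.Structures using (IsEquivalence)
open import Relation.Nullary.Decidable.Core using (yes; no)
open import Relation.Nullary.Negation.Core using (¬_)
open import Relation.Unary using (Pred)

-- Order arithmetic, the Archimedean property and density of the rationals.

module OrderedField (lem : ExcludedMiddle 0ℓ) (ℝ : CompleteOrderedField) where

  open CompleteOrderedField ℝ
  open GroupProperties +-group

  poset : Poset 0ℓ 0ℓ 0ℓ
  poset = record { isPartialOrder = ≤.isPartialOrder }

  open PartialOrderReasoning poset public

  <-trans : ∀ {x y z} → x < y → y < z → x < z
  <-trans = ToStrict.<-trans _≈_ _≤_ ≤.isPartialOrder

  <⇒≱ : ∀ {x y} → x < y → ¬ y ≤ x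
  <⇒≱ = ToStrict.<⇒≱ _≈_ _≤_ ≤.antisym

  ≰⇒> : ∀ {x y} → ¬ x ≤ y → y < x
  ≰⇒> = ToStrict.≰⇒> _≈_ _≤_ sym ≤.reflexive ≤.total

  <-≤-connex : ∀ x y → x < y ⊎ y ≤ x
  <-≤-connex x y with lem {y ≤ x}
  ... | yes y≤x = inj₂ y≤x
  ... | no  y≰x = inj₁ (≰⇒> y≰x)

  ≮⇒≥ : ∀ {x y} → ¬ x < y → y ≤ x
  ≮⇒≥ {x} {y} x≮y with <-≤-connex x y
  ... | inj₁ x<y = ⊥-elim (x≮y x<y)
  ... | inj₂ y≤x = y≤x

  +-monoʳ : ∀ z {x y} → x ≤ y → z + x ≤ z + y
  +-monoʳ z {x} {y} x≤y = begin
    z + x  ≈⟨ +-comm z x ⟩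
    x + z  ≤⟨ +-monoˡ z x≤y ⟩
    y + z  ≈⟨ +-comm y z ⟩
    z + y  ∎

  +-monoˡ-< : ∀ z {x y} → x < y → x + z < y + z
  +-monoˡ-< z (x≤y , x≉y) = +-monoˡ z x≤y , x≉y ∘ ∙-cancelʳ z _ _

  +-monoʳ-< : ∀ z {x y} → x < y → z + x < z + y
  +-monoʳ-< z (x≤y , x≉y) = +-monoʳ z x≤y , x≉y ∘ ∙-cancelˡ z _ _

  x-y+y≈x : ∀ x y → (x - y) + y ≈ x
  x-y+y≈x x y = //-rightDividesˡ y x

  x+y-y≈x : ∀ x y → (x + y) - y ≈ x
  x+y-y≈x x y = //-rightDividesʳ y x

  x+y<z⇒x<z-y : ∀ {x y z} → x + y < z → x < z - y
  x+y<z⇒x<z-y {x} {y} {z} lt = begin-strict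
    x            ≈⟨ x+y-y≈x x y ⟨
    (x + y) - y  <⟨ +-monoˡ-< (- y) lt ⟩
    z - y        ∎

  x<z-y⇒x+y<z : ∀ {x y z} → x < z - y → x + y < z
  x<z-y⇒x+y<z {x} {y} {z} lt = begin-strict
    x + y        <⟨ +-monoˡ-< y lt ⟩
    (z - y) + y  ≈⟨ x-y+y≈x z y ⟩
    z            ∎

  x-y<z⇒x<z+y : ∀ {x y z} → x - y < z → x < z + y
  x-y<z⇒x<z+y {x} {y} {z} lt = begin-strict
    x            ≈⟨ x-y+y≈x x y ⟨
    (x - y) + y  <⟨ +-monoˡ-< y lt ⟩
    z + y        ∎

  x<z+y⇒x-y<z : ∀ {x y z} → x < z + y → x - y < z
  x<z+y⇒x-y<z {x} {y} {z} lt = begin-strict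
    x - y        <⟨ +-monoˡ-< (- y) lt ⟩
    (z + y) - y  ≈⟨ x+y-y≈x z y ⟩
    z            ∎

  x<y⇒0<y-x : ∀ {x y} → x < y → 0# < y - x
  x<y⇒0<y-x {x} {y} x<y = x+y<z⇒x<z-y (begin-strict
    0# + x  ≈⟨ +-identityˡ x ⟩
    x       <⟨ x<y ⟩
    y       ∎)

  x<x+y : ∀ x {y} → 0# < y → x < x + y
  x<x+y x {y} 0<y = begin-strict
    x       ≈⟨ +-identityʳ x ⟨
    x + 0#  <⟨ +-monoʳ-< x 0<y ⟩
    x + y   ∎

  neg-anti-< : ∀ {x y} → x < - y → y < - x
  neg-anti-< {x} {y} x<-y = begin-strict
    y       ≈⟨ +-identityˡ y ⟨
    0# + y  <⟨ x+y<z⇒x<z-y (begin-strict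
      (0# + y) + x  ≈⟨ +-congʳ (+-identityˡ y) ⟩
      y + x         ≈⟨ +-comm y x ⟩
      x + y         <⟨ x<z-y⇒x+y<z (begin-strict
        x       <⟨ x<-y ⟩
        - y     ≈⟨ +-identityˡ (- y) ⟨
        0# - y  ∎) ⟩
      0#            ∎) ⟩
    0# - x  ≈⟨ +-identityˡ (- x) ⟩
    - x     ∎

  *-monoʳ-nonNeg : ∀ {x y z} → 0# ≤ z → x ≤ y → x * z ≤ y * z
  *-monoʳ-nonNeg {x} {y} {z} 0≤z x≤y = begin
    x * z                        ≈⟨ +-identityˡ _ ⟨
    0# + x * z                   ≤⟨ +-monoˡ (x * z) (*-nonNeg 0≤y-x 0≤z) ⟩
    (y - x) * z + x * z          ≈⟨ distribʳ z (y - x) x ⟨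
    ((y - x) + x) * z            ≈⟨ *-congʳ (x-y+y≈x y x) ⟩
    y * z                        ∎
    where
    0≤y-x : 0# ≤ y - x
    0≤y-x = begin
      0#     ≈⟨ -‿inverseʳ x ⟨
      x - x  ≤⟨ +-monoˡ (- x) x≤y ⟩
      y - x  ∎

  fromℕ : ℕ → Carrier
  fromℕ zero    = 0#
  fromℕ (suc n) = fromℕ n + 1#

  n<n+1 : ∀ n → fromℕ n < fromℕ (suc n)
  n<n+1 n = x<x+y (fromℕ n) 0<1

  0≤n : ∀ n → 0# ≤ fromℕ n
  0≤n zero    = ≤.refl
  0≤n (suc n) = ≤.trans (0≤n n) (proj₁ (n<n+1 n))

  0<1+n : ∀ n → 0# < fromℕ (suc n)
  0<1+n n = begin-strict
    0#             ≤⟨ 0≤n n ⟩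
    fromℕ n        <⟨ n<n+1 n ⟩
    fromℕ (suc n)  ∎

  -- A supremum v of the naturals would make v - 1 an upper bound as well.
  archimedean : ∀ x → ∃ λ n → x < fromℕ n
  archimedean x with lem {∃ λ n → x < fromℕ n}
  ... | yes found = found
  ... | no  none  = ⊥-elim (contradictory (complete (λ y → ∃ λ n → y ≈ fromℕ n)
      (0# , 0 , refl)
      (x , λ { y (n , y≈n) → ≤.trans (≤.reflexive y≈n) (≮⇒≥ (λ x<n → none (n , x<n))) })))
    where
    contradictory : ¬ ∃ (IsSup (λ y → ∃ λ n → y ≈ fromℕ n))
    contradictory (v , upper , least) =
      <⇒≱ (x<z+y⇒x-y<z (x<x+y v 0<1)) (least (v - 1#) λ { y (n , y≈n) → begin
        y                   ≈⟨ y≈n ⟩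
        fromℕ n             ≈⟨ x+y-y≈x (fromℕ n) 1# ⟨
        fromℕ (suc n) - 1#  ≤⟨ +-monoˡ (- 1#) (upper _ (suc n , refl)) ⟩
        v - 1#              ∎ })

  -- Walk down from an Archimedean bound until the predecessor drops to `x` or below; `0# ≤ x`
  -- prevents the walk from reaching zero.
  nextInteger : ∀ {x} → 0# ≤ x → ∃ λ n → x < fromℕ n × fromℕ n ≤ x + 1#
  nextInteger {x} 0≤x = uncurry descend (archimedean x)
    where
    descend : ∀ n → x < fromℕ n → ∃ λ n → x < fromℕ n × fromℕ n ≤ x + 1#
    descend zero    x<0 = ⊥-elim (<⇒≱ x<0 0≤x)
    descend (suc n) x<1+n with <-≤-connex x (fromℕ n)
    ... | inj₁ x<n = descend n x<n
    ... | inj₂ n≤x = suc n , x<1+n , +-monoˡ 1# n≤x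

  reciprocal : ∀ n → ∃ λ y → fromℕ (suc n) * y ≈ 1#
  reciprocal n = inverse (fromℕ (suc n)) (proj₂ (0<1+n n) ∘ sym)

  -- If `e` is the inverse of `d` and `e < fromℕ n`, then `(n + 1) d` is at least
  -- `(e + 1) d = 1 + d`, and the extra `d` makes the inequality strict.
  multiple-exceeds : ∀ {d} → 0# < d → ∃ λ n → 1# < d * fromℕ (suc n)
  multiple-exceeds {d} 0<d = from-inverse (inverse d (proj₂ 0<d ∘ sym))
    where
    from-inverse : (∃ λ e → d * e ≈ 1#) → ∃ λ n → 1# < d * fromℕ (suc n)
    from-inverse (e , de≈1) = from-bound (archimedean e)
      where
      from-bound : (∃ λ n → e < fromℕ n) → ∃ λ n → 1# < d * fromℕ (suc n)
      from-bound (n , e<n) = n , (begin-strict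
        1#                      <⟨ x<x+y 1# 0<d ⟩
        1# + d                  ≈⟨ +-cong de≈1 (*-identityˡ d) ⟨
        d * e + 1# * d          ≈⟨ +-congʳ (*-comm d e) ⟩
        e * d + 1# * d          ≈⟨ distribʳ d e 1# ⟨
        (e + 1#) * d            ≤⟨ *-monoʳ-nonNeg (proj₁ 0<d) (+-monoˡ 1# (proj₁ e<n)) ⟩
        fromℕ (suc n) * d       ≈⟨ *-comm _ d ⟩
        d * fromℕ (suc n)       ∎)

  -- An interval longer than 1 contains an integer, here a difference of two naturals: translate by
  -- a natural `k` above `- x` so that the left end becomes non-negative, and take the next integer
  -- there.
  difference-between : ∀ {x y} → x + 1# < y →
    ∃ λ m → ∃ λ k → x < fromℕ m - fromℕ k × fromℕ m - fromℕ k < y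
  difference-between {x} {y} x+1<y = shift (archimedean (- x))
    where
    shift : (∃ λ k → - x < fromℕ k) →
            ∃ λ m → ∃ λ k → x < fromℕ m - fromℕ k × fromℕ m - fromℕ k < y
    shift (k , -x<k) = round (nextInteger (begin
        0#           ≈⟨ -‿inverseʳ x ⟨
        x - x        ≤⟨ +-monoʳ x (proj₁ -x<k) ⟩
        x + fromℕ k  ∎))
      where
      round : (∃ λ m → x + fromℕ k < fromℕ m × fromℕ m ≤ (x + fromℕ k) + 1#) →
              ∃ λ m → ∃ λ k → x < fromℕ m - fromℕ k × fromℕ m - fromℕ k < y
      round (m , x+k<m , m≤x+k+1) = m , k , x+y<z⇒x<z-y x+k<m , x<z+y⇒x-y<z (begin-strict
        fromℕ m             ≤⟨ m≤x+k+1 ⟩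
        (x + fromℕ k) + 1#  ≈⟨ +-assoc _ _ _ ⟩
        x + (fromℕ k + 1#)  ≈⟨ +-congˡ (+-comm _ _) ⟩
        x + (1# + fromℕ k)  ≈⟨ +-assoc _ _ _ ⟨
        (x + 1#) + fromℕ k  <⟨ +-monoˡ-< (fromℕ k) x+1<y ⟩
        y + fromℕ k         ∎)

  abstract

    -- The rational (m - k) / (1 + n).
    fraction : ℕ × ℕ × ℕ → Carrier
    fraction (m , k , n) = (fromℕ m - fromℕ k) * proj₁ (reciprocal n)

    fraction-*-denominator : ∀ m k n →
      fraction (m , k , n) * fromℕ (suc n) ≈ fromℕ m - fromℕ k
    fraction-*-denominator m k n = cancel (proj₂ (reciprocal n))
      where
      cancel : ∀ {w c c⁻¹} → c * c⁻¹ ≈ 1# → (w * c⁻¹) * c ≈ w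
      cancel {w} {c} {c⁻¹} cc⁻¹≈1 = begin-equality
        (w * c⁻¹) * c  ≈⟨ *-assoc w c⁻¹ c ⟩
        w * (c⁻¹ * c)  ≈⟨ *-congˡ (*-comm c⁻¹ c) ⟩
        w * (c * c⁻¹)  ≈⟨ *-congˡ cc⁻¹≈1 ⟩
        w * 1#         ≈⟨ *-identityʳ w ⟩
        w              ∎

    -- A multiple (x c , y c) of the interval (x , y) is longer than 1.
    fraction-dense : ∀ {x y} → x < y → ∃ λ r → x < fraction r × fraction r < y
    fraction-dense {x} {y} x<y = scale (multiple-exceeds (x<y⇒0<y-x x<y))
      where
      Between : Set
      Between = ∃ λ r → x < fraction r × fraction r < y
      scale : (∃ λ n → 1# < (y - x) * fromℕ (suc n)) → Between
      scale (n , 1<dc) = unscale (difference-between (begin-strict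
          x * c + 1#           <⟨ +-monoʳ-< (x * c) 1<dc ⟩
          x * c + (y - x) * c  ≈⟨ +-comm _ _ ⟩
          (y - x) * c + x * c  ≈⟨ distribʳ c (y - x) x ⟨
          ((y - x) + x) * c    ≈⟨ *-congʳ (x-y+y≈x y x) ⟩
          y * c                ∎))
        where
        c : Carrier
        c = fromℕ (suc n)
        unscale : (∃ λ m → ∃ λ k → x * c < fromℕ m - fromℕ k × fromℕ m - fromℕ k < y * c) →
                  Between
        unscale (m , k , xc<w , w<yc) = (m , k , n) ,
          ≰⇒> (λ r≤x → <⇒≱ xc<w (begin
            fromℕ m - fromℕ k         ≈⟨ fraction-*-denominator m k n ⟨
            fraction (m , k , n) * c  ≤⟨ *-monoʳ-nonNeg (0≤n (suc n)) r≤x ⟩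
            x * c                     ∎)) ,
          ≰⇒> (λ y≤r → <⇒≱ w<yc (begin
            y * c                     ≤⟨ *-monoʳ-nonNeg (0≤n (suc n)) y≤r ⟩
            fraction (m , k , n) * c  ≈⟨ fraction-*-denominator m k n ⟩
            fromℕ m - fromℕ k         ∎))

-- Generated σ-algebras, preimages and descent along a map.

module SigmaAlgebras (lem : ExcludedMiddle 0ℓ) (ℝ : CompleteOrderedField) where

  open GameLogic lem ℝ
  open Equivalence using (to; from)
  open MeasurableSpace using (Measurable)

  T-not-intro : ∀ b → ¬ T b → T (not b)
  T-not-intro true  ¬t = ¬t _
  T-not-intro false _  = _

  T-not-elim : ∀ b → T (not b) → ¬ T b
  T-not-elim false _ ()

  T-⇔⇒≡ : ∀ a b → (T a → T b) → (T b → T a) → a ≡ b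
  T-⇔⇒≡ true  true  _ _ = ≡.refl
  T-⇔⇒≡ false false _ _ = ≡.refl
  T-⇔⇒≡ true  false f _ = ⊥-elim (f _)
  T-⇔⇒≡ false true  _ g = ⊥-elim (g _)

  ∈-⋃⁻ : {X : Setoid 0ℓ 0ℓ} {I : Set} (A : I → 𝒫 X) (x : ∣ X ∣) → x ∈ ⋃ A → ∃ λ i → x ∈ A i
  ∈-⋃⁻ A x = ⌊⌋-elim

  ∈-⋃⁺ : {X : Setoid 0ℓ 0ℓ} {I : Set} (A : I → 𝒫 X) (x : ∣ X ∣) → (∃ λ i → x ∈ A i) → x ∈ ⋃ A
  ∈-⋃⁺ A x = ⌊⌋-intro

  σ-isSigmaAlgebra : {X : Setoid 0ℓ 0ℓ} (𝒜 : Pred (𝒫 X) 0ℓ) → IsSigmaAlgebra (σ 𝒜)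
  σ-isSigmaAlgebra 𝒜 = MeasurableSpace.isSigmaAlgebra (generatedBy 𝒜)

  -- The sets whose preimage lies in `ℳ` form a σ-algebra, so checking generators is enough.
  σ-preimage : {X Y : Setoid 0ℓ 0ℓ} (f : Func X Y) {𝒜 : Pred (𝒫 Y) 0ℓ} {ℳ : Pred (𝒫 X) 0ℓ} →
    IsSigmaAlgebra ℳ → (∀ A → 𝒜 A → ℳ (f ⁻¹[ A ])) → ∀ {A} → σ 𝒜 A → ℳ (f ⁻¹[ A ])
  σ-preimage f ℳ-σ h (gen A∈)        = h _ A∈
  σ-preimage f ℳ-σ h (resp A≐B A∈)   =
    IsSigmaAlgebra.resp ℳ-σ (A≐B ∘ (f ⟨$⟩_)) (σ-preimage f ℳ-σ h A∈)
  σ-preimage f ℳ-σ h full∈           =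
    IsSigmaAlgebra.resp ℳ-σ (λ _ → ≡.refl) (IsSigmaAlgebra.full∈ ℳ-σ)
  σ-preimage f ℳ-σ h (∁-closed A∈)   =
    IsSigmaAlgebra.resp ℳ-σ (λ _ → ≡.refl) (IsSigmaAlgebra.∁-closed ℳ-σ (σ-preimage f ℳ-σ h A∈))
  σ-preimage f ℳ-σ h (⋃-closed A A∈) =
    IsSigmaAlgebra.resp ℳ-σ (λ _ → ≡.refl)
      (IsSigmaAlgebra.⋃-closed ℳ-σ (λ n → f ⁻¹[ A n ]) (λ n → σ-preimage f ℳ-σ h (A∈ n)))

  -- The preimages of members of `ℳ` form a σ-algebra on `X`. This is what carries invariant sets
  -- down to a quotient.
  σ-descend : {X Y : Setoid 0ℓ 0ℓ} (f : Func X Y) {𝒜 : Pred (𝒫 X) 0ℓ} {ℳ : Pred (𝒫 Y) 0ℓ} →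
    IsSigmaAlgebra ℳ → (∀ A → 𝒜 A → ∃ λ B → ℳ B × A ≐ f ⁻¹[ B ]) →
    ∀ {A} → σ 𝒜 A → ∃ λ B → ℳ B × A ≐ f ⁻¹[ B ]
  σ-descend f ℳ-σ h (gen A∈)      = h _ A∈
  σ-descend f ℳ-σ h (resp A≐A′ A∈) with σ-descend f ℳ-σ h A∈
  ... | B , B∈ , A≐B = B , B∈ , λ x → ≡.trans (≡.sym (A≐A′ x)) (A≐B x)
  σ-descend f ℳ-σ h full∈         = full , IsSigmaAlgebra.full∈ ℳ-σ , λ _ → ≡.refl
  σ-descend f ℳ-σ h (∁-closed A∈) with σ-descend f ℳ-σ h A∈
  ... | B , B∈ , A≐B = ∁ B , IsSigmaAlgebra.∁-closed ℳ-σ B∈ , λ x → ≡.cong not (A≐B x)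
  -- A lift of each `A n` is computed from its derivation, so the lifts form a sequence outright.
  σ-descend f ℳ-σ h (⋃-closed A A∈) =
    ⋃ B , IsSigmaAlgebra.⋃-closed ℳ-σ B (λ n → proj₁ (proj₂ (lifted n))) ,
    λ x → ⌊⌋-cong (λ { (n , x∈A) → n , ≡.subst T (A≐B n x) x∈A })
                  (λ { (n , x∈B) → n , ≡.subst T (≡.sym (A≐B n x)) x∈B })
    where
    lifted = λ n → σ-descend f ℳ-σ h (A∈ n)
    B      = λ n → proj₁ (lifted n)
    A≐B    = λ n → proj₂ (proj₂ (lifted n))

  -- Measurable predicates and measurable real functions.

  module Events {X : Setoid 0ℓ 0ℓ} {ℳ : Pred (𝒫 X) 0ℓ} (ℳ-σ : IsSigmaAlgebra ℳ) where

    private module ℳ = IsSigmaAlgebra ℳ-σ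

    -- Tying a predicate to a set of `ℳ` lets measurability be proved along the logical structure of
    -- a condition instead of with Boolean-valued maps.
    record IsEvent (P : Pred ∣ X ∣ 0ℓ) : Set where
      constructor event
      field
        carrier   : 𝒫 X
        carrier∈  : ℳ carrier
        carrier⇔  : ∀ x → x ∈ carrier ⇔ P x

    open IsEvent

    event⇒∈ : ∀ {P} → IsEvent P → ∀ A → (∀ x → x ∈ A ⇔ P x) → ℳ A
    event⇒∈ e A A⇔P = ℳ.resp
      (λ x → T-⇔⇒≡ _ _ (from (A⇔P x) ∘ to (carrier⇔ e x)) (from (carrier⇔ e x) ∘ to (A⇔P x)))
      (carrier∈ e)

    event-resp : ∀ {P Q} → (∀ x → P x ⇔ Q x) → IsEvent P → IsEvent Q
    event-resp P⇔Q (event A A∈ A⇔P) = event A A∈ λ x →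
      mk⇔ (to (P⇔Q x) ∘ to (A⇔P x)) (from (A⇔P x) ∘ from (P⇔Q x))

    event-¬ : ∀ {P} → IsEvent P → IsEvent (λ x → ¬ P x)
    event-¬ (event A A∈ A⇔P) = event (∁ A) (ℳ.∁-closed A∈) λ x →
      mk⇔ (λ x∉A px → T-not-elim _ x∉A (from (A⇔P x) px))
          (λ ¬px → T-not-intro _ (¬px ∘ to (A⇔P x)))

    event-∃ℕ : {P : ℕ → Pred ∣ X ∣ 0ℓ} → (∀ n → IsEvent (P n)) → IsEvent (λ x → ∃ λ n → P n x)
    event-∃ℕ e = event (⋃ (carrier ∘ e)) (ℳ.⋃-closed _ (carrier∈ ∘ e)) λ x →
      mk⇔ (λ x∈⋃ → let (n , x∈) = ∈-⋃⁻ (carrier ∘ e) x x∈⋃ in n , to (carrier⇔ (e n) x) x∈)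
          (λ { (n , p) → ∈-⋃⁺ (carrier ∘ e) x (n , from (carrier⇔ (e n) x) p) })

    -- Side conditions such as `fraction r < c` do not depend on the point; excluded middle picks
    -- the whole set or the empty one.
    event-const : ∀ P → IsEvent (λ _ → P)
    event-const P with lem {P}
    ... | yes p = event full ℳ.full∈ λ _ → mk⇔ (λ _ → p) _
    ... | no ¬p = event (∁ full) (ℳ.∁-closed ℳ.full∈) λ _ → mk⇔ (λ ()) ¬p

    event-⊎ : ∀ {P Q} → IsEvent P → IsEvent Q → IsEvent (λ x → P x ⊎ Q x)
    event-⊎ {P} {Q} eP eQ = event-resp
      (λ x → mk⇔ (λ { (zero , p) → inj₁ p ; (suc _ , q) → inj₂ q })
                 (λ { (inj₁ p) → 0 , p ; (inj₂ q) → 1 , q }))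
      (event-∃ℕ alternative)
      where
      -- The binary union as a countable one: `P` at index 0 and `Q` at every later index.
      P⊎Q : ℕ → Pred ∣ X ∣ 0ℓ
      P⊎Q zero    = P
      P⊎Q (suc _) = Q
      alternative : ∀ n → IsEvent (P⊎Q n)
      alternative zero    = eP
      alternative (suc _) = eQ

    event-× : ∀ {P Q} → IsEvent P → IsEvent Q → IsEvent (λ x → P x × Q x)
    event-× {P} {Q} eP eQ = event-resp
      (λ x → mk⇔ deMorgan (λ { (p , q) (inj₁ ¬p) → ¬p p ; (p , q) (inj₂ ¬q) → ¬q q }))
      (event-¬ (event-⊎ (event-¬ eP) (event-¬ eQ)))
      where
      deMorgan : ∀ {P Q : Set} → ¬ (¬ P ⊎ ¬ Q) → P × Q
      deMorgan {P} {Q} h with lem {P} | lem {Q}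
      ... | yes p | yes q = p , q
      ... | no ¬p | _     = ⊥-elim (h (inj₁ ¬p))
      ... | _     | no ¬q = ⊥-elim (h (inj₂ ¬q))

    -- Quantification over the rationals: the index triples of `fraction` are exhausted by three
    -- nested countable unions.
    event-∃ℕ³ : {P : ℕ × ℕ × ℕ → Pred ∣ X ∣ 0ℓ} → (∀ r → IsEvent (P r)) →
                IsEvent (λ x → ∃ λ r → P r x)
    event-∃ℕ³ e = event-resp
      (λ x → mk⇔ (λ { (m , k , n , p) → (m , k , n) , p }) (λ { ((m , k , n) , p) → m , k , n , p }))
      (event-∃ℕ λ m → event-∃ℕ λ k → event-∃ℕ λ n → e (m , k , n))

    open OrderedField lem ℝ
    open ℝ using (0#; _≤_; _<_; _+_; _-_; -_; _≈_) renaming (Carrier to R)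

    -- Strict upper level sets are chosen because, for an evaluation, they are the sets `β`.
    MeasurableFunction : Pred (∣ X ∣ → R) 0ℓ
    MeasurableFunction f = ∀ c → IsEvent (λ x → c < f x)

    measurable-resp : ∀ {f g} → (∀ x → f x ≈ g x) → MeasurableFunction f → MeasurableFunction g
    measurable-resp {f} {g} f≈g f-meas c = event-resp
      (λ x → mk⇔ (λ c<f → begin-strict c <⟨ c<f ⟩ f x ≈⟨ f≈g x ⟩ g x ∎)
                 (λ c<g → begin-strict c <⟨ c<g ⟩ g x ≈⟨ f≈g x ⟨ f x ∎))
      (f-meas c)

    measurable-const : ∀ r → MeasurableFunction (λ _ → r)
    measurable-const r c = event-const (c < r)

    -- `f x < c` holds iff `f x ≤ r < c` for some rational `r`, and `f x ≤ r` is the complement of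
    -- an upper level set.
    measurable⇒below : ∀ {f} → MeasurableFunction f → ∀ c → IsEvent (λ x → f x < c)
    measurable⇒below {f} f-meas c = event-resp
      (λ x → mk⇔
        (λ { (r , r<c , r≮f) → begin-strict
             f x         ≤⟨ ≮⇒≥ r≮f ⟩
             fraction r  <⟨ r<c ⟩
             c           ∎ })
        (λ f<c → let (r , f<r , r<c) = fraction-dense f<c
                 in r , r<c , λ r<f → <⇒≱ r<f (proj₁ f<r)))
      (event-∃ℕ³ λ r → event-× (event-const (fraction r < c)) (event-¬ (f-meas (fraction r))))

    measurable-neg : ∀ {f} → MeasurableFunction f → MeasurableFunction (λ x → - f x)
    measurable-neg f-meas c = event-resp
      (λ x → mk⇔ neg-anti-< neg-anti-<) (measurable⇒below f-meas (- c))

    -- `c < f x + g x` holds iff some rational `r` satisfies `r < f x` and `c - r < g x`: take `r`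
    -- strictly between `c - g x` and `f x`.
    measurable-+ : ∀ {f g} → MeasurableFunction f → MeasurableFunction g →
                   MeasurableFunction (λ x → f x + g x)
    measurable-+ {f} {g} f-meas g-meas c = event-resp
      (λ x → mk⇔
        (λ { (r , r<f , c-r<g) → begin-strict
             c               <⟨ x-y<z⇒x<z+y c-r<g ⟩
             g x + fraction r <⟨ +-monoʳ-< (g x) r<f ⟩
             g x + f x       ≈⟨ ℝ.+-comm (g x) (f x) ⟩
             f x + g x       ∎ })
        (λ c<f+g → let (r , c-g<r , r<f) = fraction-dense (x<z+y⇒x-y<z c<f+g)
                   in r , r<f , x<z+y⇒x-y<z (begin-strict
                        c                 <⟨ x-y<z⇒x<z+y c-g<r ⟩
                        fraction r + g x  ≈⟨ ℝ.+-comm _ _ ⟩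
                        g x + fraction r  ∎)))
      (event-∃ℕ³ λ r → event-× (f-meas (fraction r)) (g-meas (c - fraction r)))

    measurable-partialSum : ∀ {f : ∣ X ∣ → ℕ → R} → (∀ n → MeasurableFunction (λ x → f x n)) →
                            ∀ n → MeasurableFunction (λ x → partialSum (f x) n)
    measurable-partialSum f-meas zero    = measurable-const 0#
    measurable-partialSum f-meas (suc n) =
      measurable-+ (f-meas 0) (measurable-partialSum (f-meas ∘ suc) n)

    -- The sum is the supremum of the partial sums, so it exceeds `c` iff one of them does.
    measurable-HasSum : ∀ {f : ∣ X ∣ → ℕ → R} {g} → (∀ n → MeasurableFunction (λ x → f x n)) →
                        (∀ x → HasSum (f x) (g x)) → MeasurableFunction g
    measurable-HasSum {f} {g} f-meas sums c = event-resp
      (λ x → mk⇔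
        (λ { (n , c<s) → begin-strict
             c                   <⟨ c<s ⟩
             partialSum (f x) n  ≤⟨ proj₁ (sums x) _ (n , ℝ.refl) ⟩
             g x                 ∎ })
        (exceeded x))
      (event-∃ℕ λ n → measurable-partialSum f-meas n c)
      where
      exceeded : ∀ x → c < g x → ∃ λ n → c < partialSum (f x) n
      exceeded x c<g with lem {∃ λ n → c < partialSum (f x) n}
      ... | yes found = found
      ... | no  none  = ⊥-elim (<⇒≱ c<g (proj₂ (sums x) c bounded))
        where
        bounded : ∀ y → (∃ λ n → y ≈ partialSum (f x) n) → y ≤ c
        bounded y (n , y≈) with <-≤-connex c y
        ... | inj₂ y≤c = y≤c
        ... | inj₁ c<y = ⊥-elim (none (n , (begin-strict c <⟨ c<y ⟩ y ≈⟨ y≈ ⟩ partialSum (f x) n ∎)))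

    -- An open set is the union of the intervals with rational end points it contains.
    measurable⇒Borel : (f : Func X 𝕀) → MeasurableFunction (λ x → proj₁ (f ⟨$⟩ x)) →
                       ∀ {B} → Measurable [0,1] B → ℳ (f ⁻¹[ B ])
    measurable⇒Borel f f-meas = σ-preimage f ℳ-σ open∈
      where
      open∈ : ∀ U → Open U → ℳ (f ⁻¹[ U ])
      open∈ U U-open = event⇒∈
        (event-∃ℕ³ λ p → event-∃ℕ³ λ q → event-×
          (event-const (∀ y → fraction p < proj₁ y → proj₁ y < fraction q → y ∈ U))
          (event-× (f-meas (fraction p)) (measurable⇒below f-meas (fraction q))))
        (f ⁻¹[ U ])
        λ x → mk⇔
          (λ fx∈U →
            let (d , 0<d , ball⊆U) = U-open (f ⟨$⟩ x) fx∈U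
                (p , x-d<p , p<x) = fraction-dense (x<z+y⇒x-y<z (x<x+y (proj₁ (f ⟨$⟩ x)) 0<d))
                (q , x<q , q<x+d) = fraction-dense (x<x+y (proj₁ (f ⟨$⟩ x)) 0<d)
            in p , q , (λ y p<y y<q → ball⊆U y
                         (x-y<z⇒x<z+y (<-trans x-d<p p<y)) (<-trans y<q q<x+d))
                     , p<x , x<q)
          (λ { (p , q , between , p<x , x<q) → between (f ⟨$⟩ x) p<x x<q })

  -- Dynkin's π-λ theorem.

  module _ {X : Setoid 0ℓ 0ℓ} where

    Disjoint : Pred (ℕ → 𝒫 X) 0ℓ
    Disjoint A = ∀ i j → i ≢ j → ∀ x → x ∈ A i → ¬ x ∈ A j

    -- Differs from `σ` only in admitting unions of disjoint sequences alone, the unions that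
    -- σ-additivity controls.
    data λ-system (𝒜 : Pred (𝒫 X) 0ℓ) : Pred (𝒫 X) 0ℓ where
      gen      : ∀ {A} → 𝒜 A → λ-system 𝒜 A
      resp     : ∀ {A B} → A ≐ B → λ-system 𝒜 A → λ-system 𝒜 B
      full∈    : λ-system 𝒜 full
      ∁-closed : ∀ {A} → λ-system 𝒜 A → λ-system 𝒜 (∁ A)
      ⋃-closed : (A : ℕ → 𝒫 X) → Disjoint A → (∀ n → λ-system 𝒜 (A n)) → λ-system 𝒜 (⋃ A)

    -- Presents a binary union as a countable one; padding with `∅` rather than repeating `B` keeps
    -- the sequence disjoint.
    followedBy∅ : 𝒫 X → 𝒫 X → ℕ → 𝒫 X
    followedBy∅ A B zero          = A
    followedBy∅ A B (suc zero)    = B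
    followedBy∅ A B (suc (suc _)) = ∅

    followedBy∅-disjoint : ∀ A B → (∀ x → x ∈ A → ¬ x ∈ B) → Disjoint (followedBy∅ A B)
    followedBy∅-disjoint A B d zero          zero          i≢j = ⊥-elim (i≢j ≡.refl)
    followedBy∅-disjoint A B d zero          (suc zero)    i≢j = d
    followedBy∅-disjoint A B d zero          (suc (suc _)) i≢j = λ _ _ ()
    followedBy∅-disjoint A B d (suc zero)    zero          i≢j = λ x x∈B x∈A → d x x∈A x∈B
    followedBy∅-disjoint A B d (suc zero)    (suc zero)    i≢j = ⊥-elim (i≢j ≡.refl)
    followedBy∅-disjoint A B d (suc zero)    (suc (suc _)) i≢j = λ _ _ ()
    followedBy∅-disjoint A B d (suc (suc _)) j             i≢j = λ _ ()

    ⋃-followedBy∅ : ∀ A B → ⋃ (followedBy∅ A B) ≐ A ∪ B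
    ⋃-followedBy∅ A B x = T-⇔⇒≡ _ _
      (case-followed ∘ ∈-⋃⁻ (followedBy∅ A B) x)
      (∈-⋃⁺ (followedBy∅ A B) x ∘ case-union ∘ to T-∨)
      where
      case-followed : (∃ λ n → x ∈ followedBy∅ A B n) → x ∈ A ∪ B
      case-followed (zero     , x∈A) = from T-∨ (inj₁ x∈A)
      case-followed (suc zero , x∈B) = from (T-∨ {A ⟨$⟩ x}) (inj₂ x∈B)
      case-union : x ∈ A ⊎ x ∈ B → ∃ λ n → x ∈ followedBy∅ A B n
      case-union (inj₁ x∈A) = 0 , x∈A
      case-union (inj₂ x∈B) = 1 , x∈B

    module _ {𝒜 : Pred (𝒫 X) 0ℓ} where

      ∅∈ : λ-system 𝒜 ∅
      ∅∈ = resp (λ _ → ≡.refl) (∁-closed full∈)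

      disjoint-∪-closed : ∀ {A B} → (∀ x → x ∈ A → ¬ x ∈ B) →
                          λ-system 𝒜 A → λ-system 𝒜 B → λ-system 𝒜 (A ∪ B)
      disjoint-∪-closed {A} {B} d A∈ B∈ = resp (⋃-followedBy∅ A B)
        (⋃-closed (followedBy∅ A B) (followedBy∅-disjoint A B d) terms)
        where
        terms : ∀ n → λ-system 𝒜 (followedBy∅ A B n)
        terms zero          = A∈
        terms (suc zero)    = B∈
        terms (suc (suc _)) = ∅∈

      -- A ∩ ∁ B is the complement of the disjoint union ∁ A ∪ (A ∩ B).
      ∩-closed-from-generators : ∀ {C} → λ-system 𝒜 C → (∀ {A} → 𝒜 A → λ-system 𝒜 (C ∩ A)) →
                                 ∀ {A} → λ-system 𝒜 A → λ-system 𝒜 (C ∩ A)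
      ∩-closed-from-generators C∈ h (gen A∈) = h A∈
      ∩-closed-from-generators {C} C∈ h (resp A≐B A∈) =
        resp (λ x → ≡.cong ((C ⟨$⟩ x) ∧_) (A≐B x)) (∩-closed-from-generators C∈ h A∈)
      ∩-closed-from-generators {C} C∈ h full∈ = resp (λ x → ≡.sym (∧-identityʳ (C ⟨$⟩ x))) C∈
      ∩-closed-from-generators {C} C∈ h (∁-closed {A} A∈) =
        resp (λ x → relative (C ⟨$⟩ x) (A ⟨$⟩ x))
          (∁-closed (disjoint-∪-closed {∁ C} {C ∩ A}
            (λ x x∉C x∈C∩A → T-not-elim _ x∉C (proj₁ (to (T-∧ {_} {A ⟨$⟩ x}) x∈C∩A)))
            (∁-closed C∈) (∩-closed-from-generators C∈ h A∈)))
        where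
        relative : ∀ c a → not (not c ∨ (c ∧ a)) ≡ c ∧ not a
        relative true  _ = ≡.refl
        relative false _ = ≡.refl
      ∩-closed-from-generators {C} C∈ h (⋃-closed A d A∈) =
        resp (λ x → T-⇔⇒≡ _ _
            (λ x∈⋃ → let (n , x∈) = ∈-⋃⁻ (λ n → C ∩ A n) x x∈⋃
                         (x∈C , x∈A) = to (T-∧ {C ⟨$⟩ x}) x∈
                     in from (T-∧ {C ⟨$⟩ x}) (x∈C , ∈-⋃⁺ A x (n , x∈A)))
            (λ x∈C∩⋃ → let (x∈C , x∈⋃) = to (T-∧ {C ⟨$⟩ x}) x∈C∩⋃
                           (n , x∈A) = ∈-⋃⁻ A x x∈⋃
                       in ∈-⋃⁺ (λ n → C ∩ A n) x (n , from (T-∧ {C ⟨$⟩ x}) (x∈C , x∈A))))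
          (⋃-closed (λ n → C ∩ A n)
            (λ i j i≢j x x∈i x∈j → d i j i≢j x (proj₂ (to (T-∧ {C ⟨$⟩ x}) x∈i))
                                               (proj₂ (to (T-∧ {C ⟨$⟩ x}) x∈j)))
            (λ n → ∩-closed-from-generators C∈ h (A∈ n)))

      module _ (π : ∀ {A B} → 𝒜 A → 𝒜 B → 𝒜 (A ∩ B)) where

        -- Two rounds. With a generator `B` fixed, `π` and induction on the other set give `B ∩ A`
        -- for every `A` of the system; with such an `A` fixed, the first round covers the
        -- generators and induction covers the rest.
        ∩-closed : ∀ {A B} → λ-system 𝒜 A → λ-system 𝒜 B → λ-system 𝒜 (A ∩ B)
        ∩-closed {A} A∈ = ∩-closed-from-generators A∈ λ {B} B∈ →
          resp (λ x → ∧-comm (B ⟨$⟩ x) (A ⟨$⟩ x))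
            (∩-closed-from-generators (gen B∈) (λ A′∈ → gen (π B∈ A′∈)) A∈)

        -- Stability under intersection allows an arbitrary countable union to be made disjoint by
        -- removing from each set the earlier ones.
        σ⊆λ-system : ∀ {A} → σ 𝒜 A → λ-system 𝒜 A
        σ⊆λ-system (gen A∈)        = gen A∈
        σ⊆λ-system (resp A≐B A∈)   = resp A≐B (σ⊆λ-system A∈)
        σ⊆λ-system full∈           = full∈
        σ⊆λ-system (∁-closed A∈)   = ∁-closed (σ⊆λ-system A∈)
        σ⊆λ-system (⋃-closed A A∈) = resp
          (λ x → T-⇔⇒≡ _ _
            (λ x∈⋃ → let (n , x∈) = ∈-⋃⁻ fresh x x∈⋃
                     in ∈-⋃⁺ A x (n , proj₁ (to (T-∧ {A n ⟨$⟩ x}) x∈)))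
            (λ x∈⋃ → let (n , x∈) = ∈-⋃⁻ A x x∈⋃ in ∈-⋃⁺ fresh x (first x n x∈)))
          (⋃-closed fresh fresh-disjoint λ n → ∩-closed (σ⊆λ-system (A∈ n)) (unseen∈ n))
          where
          -- `unseen n` consists of the points in no `A k` with `k < n`, so `fresh n` collects those
          -- that enter the union first at `n`.
          unseen fresh : ℕ → 𝒫 X
          unseen zero    = full
          unseen (suc n) = ∁ (A n) ∩ unseen n
          fresh n = A n ∩ unseen n
          unseen∈ : ∀ n → λ-system 𝒜 (unseen n)
          unseen∈ zero    = full∈
          unseen∈ (suc n) = ∩-closed (∁-closed (σ⊆λ-system (A∈ n))) (unseen∈ n)
          unseen⇒∉ : ∀ x {i j} → i ℕ.<′ j → x ∈ unseen j → ¬ x ∈ A i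
          unseen⇒∉ x ℕ.<′-base x∈ = T-not-elim _ (proj₁ (to T-∧ x∈))
          unseen⇒∉ x {j = suc j} (ℕ.≤′-step lt) x∈ =
            unseen⇒∉ x lt (proj₂ (to (T-∧ {not (A j ⟨$⟩ x)}) x∈))
          separated : ∀ x {i j} → i ℕ.< j → x ∈ fresh i → ¬ x ∈ fresh j
          separated x {i} {j} i<j x∈i x∈j =
            unseen⇒∉ x (<⇒<′ i<j) (proj₂ (to (T-∧ {A j ⟨$⟩ x}) x∈j)) (proj₁ (to T-∧ x∈i))
          fresh-disjoint : Disjoint fresh
          fresh-disjoint i j i≢j x x∈i x∈j with <-cmp i j
          ... | tri< i<j _ _ = separated x i<j x∈i x∈j
          ... | tri≈ _ i≡j _ = i≢j i≡j
          ... | tri> _ _ j<i = separated x j<i x∈j x∈i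
          unseen-or-first : ∀ x n → x ∈ unseen n ⊎ (∃ λ k → x ∈ fresh k)
          unseen-or-first x zero = inj₁ _
          unseen-or-first x (suc n) with unseen-or-first x n | lem {x ∈ A n}
          ... | inj₂ found | _       = inj₂ found
          ... | inj₁ x∈    | yes x∈A = inj₂ (n , from T-∧ (x∈A , x∈))
          ... | inj₁ x∈    | no  x∉A = inj₁ (from T-∧ (T-not-intro _ x∉A , x∈))
          first : ∀ x n → x ∈ A n → ∃ λ k → x ∈ fresh k
          first x n x∈A with unseen-or-first x n
          ... | inj₂ found = found
          ... | inj₁ x∈    = n , from T-∧ (x∈A , x∈)

-- Measurability of the evaluations of measures.

module Evaluations (lem : ExcludedMiddle 0ℓ) (ℝ : CompleteOrderedField) where

  open GameLogic lem ℝ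
  open OrderedField lem ℝ
  open SigmaAlgebras lem ℝ
  open MeasurableSpace using (setoid; Measurable)
  open Measure using (value)
  open ℝ using (0#; 1#; _≤_; _<_; _+_; _-_; _≈_)

  -- From length two on, all partial sums equal `a 0 + a 1`; non-negativity keeps the two shorter
  -- ones below this value.
  HasSum-two-terms : ∀ {a : ℕ → ℝ.Carrier} {v} → (∀ n → 0# ≤ a n) →
    (∀ n → a (suc (suc n)) ≈ 0#) → HasSum a v → v ≈ a 0 + a 1
  HasSum-two-terms {a} {v} a≥0 a≈0 (upper , least) = ℝ.≤.antisym
    (least (a 0 + a 1) λ { x (n , x≈) → ℝ.≤.trans (ℝ.≤.reflexive x≈) (bound n) })
    (begin
      a 0 + a 1         ≈⟨ ℝ.+-congˡ (ℝ.+-identityʳ (a 1)) ⟨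
      partialSum a 2    ≤⟨ upper _ (2 , ℝ.refl) ⟩
      v                 ∎)
    where
    tail≈0 : ∀ {b : ℕ → ℝ.Carrier} → (∀ n → b n ≈ 0#) → ∀ n → partialSum b n ≈ 0#
    tail≈0 b≈0 zero    = ℝ.refl
    tail≈0 b≈0 (suc n) = ℝ.trans (ℝ.+-cong (b≈0 0) (tail≈0 (b≈0 ∘ suc) n)) (ℝ.+-identityˡ 0#)
    bound : ∀ n → partialSum a n ≤ a 0 + a 1
    bound zero = begin
      0#          ≈⟨ ℝ.+-identityˡ 0# ⟨
      0# + 0#     ≤⟨ +-monoʳ 0# (a≥0 1) ⟩
      0# + a 1    ≤⟨ ℝ.+-monoˡ (a 1) (a≥0 0) ⟩
      a 0 + a 1   ∎
    bound (suc zero)    = +-monoʳ (a 0) (a≥0 1)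
    bound (suc (suc n)) = begin
      a 0 + (a 1 + partialSum (λ k → a (suc (suc k))) n)
        ≈⟨ ℝ.+-congˡ (ℝ.+-congˡ (tail≈0 a≈0 n)) ⟩
      a 0 + (a 1 + 0#)  ≈⟨ ℝ.+-congˡ (ℝ.+-identityʳ (a 1)) ⟩
      a 0 + a 1         ∎

  module _ (S : MeasurableSpace) where
    private module S = MeasurableSpace S

    -- `Measure` offers countable additivity only; finite additivity comes from applying it to `A`,
    -- `∁ A`, `∅`, `∅` and so on.
    value-∁ : (μ : Measure S) {A : 𝒫 S.setoid} (m : S.Measurable A) →
      proj₁ (value μ full S.full∈) - proj₁ (value μ A m) ≈ proj₁ (value μ (∁ A) (S.∁-closed m))
    value-∁ μ {A} m = begin-equality
      v full S.full∈ - v A m                             ≈⟨ ℝ.+-congʳ total ⟩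
      (v A m + v (∁ A) (S.∁-closed m)) - v A m           ≈⟨ ℝ.+-congʳ (ℝ.+-comm _ _) ⟩
      (v (∁ A) (S.∁-closed m) + v A m) - v A m           ≈⟨ x+y-y≈x _ _ ⟩
      v (∁ A) (S.∁-closed m)                             ∎
      where
      v : ∀ B → S.Measurable B → ℝ.Carrier
      v B b = proj₁ (value μ B b)
      terms = followedBy∅ A (∁ A)
      terms∈ : ∀ n → S.Measurable (terms n)
      terms∈ zero          = m
      terms∈ (suc zero)    = S.∁-closed m
      terms∈ (suc (suc n)) = S.resp (λ _ → ≡.refl) (S.∁-closed S.full∈)
      excluded-middle : ∀ b → true ≡ b ∨ not b
      excluded-middle true  = ≡.refl
      excluded-middle false = ≡.refl
      total : v full S.full∈ ≈ v A m + v (∁ A) (S.∁-closed m)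
      total = ℝ.trans
        (Measure.value-cong μ S.full∈ (S.⋃-closed terms terms∈) λ x →
          ≡.trans (excluded-middle (A ⟨$⟩ x)) (≡.sym (⋃-followedBy∅ A (∁ A) x)))
        (HasSum-two-terms (λ n → proj₁ (proj₂ (value μ (terms n) (terms∈ n))))
          (λ n → Measure.value-∅ μ _)
          (Measure.σ-additive μ terms terms∈
            (followedBy∅-disjoint A (∁ A) λ x x∈A x∉A → T-not-elim _ x∉A x∈A)))

    module _ {ℳ : Pred (𝒫 (Subₛ S)) 0ℓ} (ℳ-σ : IsSigmaAlgebra ℳ) where

      open Events ℳ-σ

      -- An evaluation takes a measurability proof as argument, so induction over a λ-system has to
      -- build both together.
      Evaluable : Pred (𝒫 S.setoid) 0ℓ
      Evaluable A = Σ[ m ∈ S.Measurable A ] MeasurableFunction (λ μ → proj₁ (value μ A m))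

      module _ {𝒞 : Pred (𝒫 S.setoid) 0ℓ} (full-evaluable : Evaluable full)
               (𝒞-evaluable : ∀ {A} → 𝒞 A → Evaluable A) where

        -- Each closure rule is matched by an operation on measurable functions: complement by
        -- subtraction from the total mass, disjoint union by a countable sum. The total mass of a
        -- subprobability varies, hence the separate assumption on `full`.
        λ-system-evaluable : ∀ {A} → λ-system 𝒞 A → Evaluable A
        λ-system-evaluable (gen A∈) = 𝒞-evaluable A∈
        λ-system-evaluable (resp A≐B A∈) with λ-system-evaluable A∈
        ... | m , meas = S.resp A≐B m ,
          measurable-resp (λ μ → Measure.value-cong μ m (S.resp A≐B m) A≐B) meas
        λ-system-evaluable full∈ = full-evaluable
        λ-system-evaluable (∁-closed A∈) with λ-system-evaluable A∈
        ... | m , meas = S.∁-closed m ,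
          measurable-resp (λ μ → ℝ.trans
              (ℝ.+-congʳ (Measure.value-cong μ _ S.full∈ (λ _ → ≡.refl))) (value-∁ μ m))
            (measurable-+ (proj₂ full-evaluable) (measurable-neg meas))
        λ-system-evaluable (⋃-closed A d A∈) =
          S.⋃-closed A (proj₁ ∘ evaluable) ,
          measurable-HasSum (proj₂ ∘ evaluable) (λ μ → Measure.σ-additive μ A (proj₁ ∘ evaluable) d)
          where evaluable = λ n → λ-system-evaluable (A∈ n)

        -- The π-λ theorem extends measurable level sets from the π-system `𝒞` to `σ 𝒞`;
        -- `measurable⇒Borel` then passes from level sets to all Borel sets.
        evaluation-measurable : (∀ {A B} → 𝒞 A → 𝒞 B → 𝒞 (A ∩ B)) → ∀ {A} → σ 𝒞 A →
          (m : S.Measurable A) → ∀ {B} → Measurable [0,1] B → ℳ (evaluation S A m ⁻¹[ B ])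
        evaluation-measurable π A∈ m = measurable⇒Borel (evaluation S _ m)
          (measurable-resp (λ μ → Measure.value-cong μ _ m (λ _ → ≡.refl))
            (proj₂ (λ-system-evaluable (σ⊆λ-system π A∈))))

    -- Formulas carry only thresholds in [0,1]. Since values lie in [0,1], the level set is
    -- everything for `c < 0#` and empty for `1# < c`.
    measurable-value : {ℳ : Pred (𝒫 (Subₛ S)) 0ℓ} (ℳ-σ : IsSigmaAlgebra ℳ) → let open Events ℳ-σ in
      ∀ {A} (m : S.Measurable A) → (∀ (q : ∣ 𝕀 ∣) → ℳ (β S A m (proj₁ q))) →
      MeasurableFunction (λ μ → proj₁ (value μ A m))
    measurable-value ℳ-σ {A} m β∈ c with <-≤-connex c 0# | <-≤-connex 1# c
    ... | inj₁ c<0 | _ = Events.event-resp ℳ-σ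
      (λ μ → mk⇔ (λ _ → begin-strict c <⟨ c<0 ⟩ 0# ≤⟨ proj₁ (proj₂ (value μ A m)) ⟩ _ ∎)
                 (λ _ → c<0))
      (Events.event-const ℳ-σ (c < 0#))
    ... | inj₂ _ | inj₁ 1<c = Events.event-resp ℳ-σ
      (λ μ → mk⇔ (λ c<1 → ⊥-elim (<⇒≱ c<1 (proj₁ 1<c)))
                 (λ c<v → begin-strict c <⟨ c<v ⟩ _ ≤⟨ proj₂ (proj₂ (value μ A m)) ⟩ 1# ∎))
      (Events.event-const ℳ-σ (c < 1#))
    ... | inj₂ 0≤c | inj₂ c≤1 =
      Events.event (β S A m c) (β∈ (c , 0≤c , c≤1)) (λ μ → mk⇔ ⌊⌋-elim ⌊⌋-intro)

  -- Sections of product-measurable sets, and intervals as Borel sets.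

  section-measurable : ∀ {X Y : MeasurableSpace} {H} → Measurable (X ⊗ Y) H →
    ∀ y → Measurable X (section {Y = setoid Y} H y)
  section-measurable {X} {Y} H∈ y = X.resp (λ _ → ≡.refl)
    (σ-preimage at-y X.isSigmaAlgebra rectangles H∈)
    where
    module X = MeasurableSpace X
    at-y : Func X.setoid (X.setoid ×ₛ setoid Y)
    at-y = record { to = _, y ; cong = λ x≈x′ → x≈x′ , MeasurableSpace.refl Y }
    rectangles : ∀ E → (∃ λ A → ∃ λ B → X.Measurable A × Measurable Y B × E ≐ rectangle A B) →
                 X.Measurable (at-y ⁻¹[ E ])
    -- The section of a rectangle at `y` is `A` or empty, according to whether `y` lies in `B`.
    rectangles E (A , B , A∈ , B∈ , E≐) with B ⟨$⟩ y in By
    ... | true  = X.resp (λ x → ≡.sym (≡.trans (E≐ (x , y))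
        (≡.trans (≡.cong ((A ⟨$⟩ x) ∧_) By) (∧-identityʳ _)))) A∈
    ... | false = X.resp (λ x → ≡.sym (≡.trans (E≐ (x , y))
        (≡.trans (≡.cong ((A ⟨$⟩ x) ∧_) By) (∧-zeroʳ _)))) (X.∁-closed X.full∈)

  -- An up-set of [0,1] is closed if it has a least element and open otherwise.
  upSet-Borel : (I : 𝒫 𝕀) → (∀ x y → x ∈ I → proj₁ x ≤ proj₁ y → y ∈ I) → Measurable [0,1] I
  upSet-Borel I up with lem {∃ λ a → a ∈ I × (∀ y → y ∈ I → proj₁ a ≤ proj₁ y)}
  ... | yes (a , a∈I , least) = event⇒∈
        (event-¬ (event (compr (λ x → proj₁ x < proj₁ a) λ {x} {y} → <-respˡ {x} {y})
          (gen ray-open) (λ x → mk⇔ ⌊⌋-elim ⌊⌋-intro))) I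
        λ x → mk⇔ (λ x∈I x<a → <⇒≱ x<a (least x x∈I)) (λ x≮a → up a x a∈I (≮⇒≥ x≮a))
    where
    open Events (MeasurableSpace.isSigmaAlgebra [0,1])
    <-respˡ : ∀ {x y : ∣ 𝕀 ∣} → proj₁ x ≈ proj₁ y → proj₁ x < proj₁ a → proj₁ y < proj₁ a
    <-respˡ {x} {y} x≈y x<a = begin-strict proj₁ y ≈⟨ x≈y ⟨ proj₁ x <⟨ x<a ⟩ proj₁ a ∎
    ray-open : Open (compr (λ x → proj₁ x < proj₁ a) λ {x} {y} → <-respˡ {x} {y})
    ray-open x x∈ = proj₁ a - proj₁ x , x<y⇒0<y-x x<a , λ y _ y<x+ε → ⌊⌋-intro (begin-strict
        proj₁ y                          <⟨ y<x+ε ⟩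
        proj₁ x + (proj₁ a - proj₁ x)    ≈⟨ ℝ.+-comm _ _ ⟩
        (proj₁ a - proj₁ x) + proj₁ x    ≈⟨ x-y+y≈x _ _ ⟩
        proj₁ a                          ∎)
      where x<a = ⌊⌋-elim x∈
  ... | no noLeast = gen I-open
    where
    I-open : Open I
    I-open x x∈I with lem {∃ λ y → y ∈ I × proj₁ y < proj₁ x}
    ... | no none = ⊥-elim (noLeast (x , x∈I , λ y y∈I → ≮⇒≥ (λ y<x → none (y , y∈I , y<x))))
    ... | yes (y , y∈I , y<x) = proj₁ x - proj₁ y , x<y⇒0<y-x y<x , λ z x<z+ε _ →
      up y z y∈I (proj₁ (begin-strict
        proj₁ y                                    ≈⟨ y≈x-ε ⟩
        proj₁ x - (proj₁ x - proj₁ y)              <⟨ x<z+y⇒x-y<z x<z+ε ⟩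
        proj₁ z                                    ∎))
      where
      y≈x-ε : proj₁ y ≈ proj₁ x - (proj₁ x - proj₁ y)
      y≈x-ε = begin-equality
        proj₁ y  ≈⟨ x+y-y≈x _ _ ⟨
        (proj₁ y + (proj₁ x - proj₁ y)) - (proj₁ x - proj₁ y)
          ≈⟨ ℝ.+-congʳ (ℝ.trans (ℝ.+-comm _ _) (x-y+y≈x _ _)) ⟩
        proj₁ x - (proj₁ x - proj₁ y)  ∎

  -- A convex set is a difference of two up-sets: the points above some element, minus the points
  -- strictly above all elements.
  Interval⇒Borel : ∀ {I} → Interval I → Measurable [0,1] I
  Interval⇒Borel {I} convex = event⇒∈
    (event-× (event above (upSet-Borel above above-up) (λ x → mk⇔ ⌊⌋-elim ⌊⌋-intro))
             (event-¬ (event beyond (upSet-Borel beyond beyond-up) (λ x → mk⇔ ⌊⌋-elim ⌊⌋-intro))))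
    I
    λ x → mk⇔
      (λ x∈I → (x , x∈I , ℝ.≤.refl) , λ beyond-x → <⇒≱ (beyond-x x x∈I) ℝ.≤.refl)
      (λ { ((y , y∈I , y≤x) , ¬beyond) → within x y y∈I y≤x ¬beyond })
    where
    open Events (MeasurableSpace.isSigmaAlgebra [0,1])
    above beyond : 𝒫 𝕀
    above = compr (λ x → ∃ λ y → y ∈ I × proj₁ y ≤ proj₁ x)
      (λ { x≈x′ (y , y∈I , y≤x) → y , y∈I , ℝ.≤.trans y≤x (ℝ.≤.reflexive x≈x′) })
    beyond = compr (λ x → ∀ y → y ∈ I → proj₁ y < proj₁ x)
      (λ {x} {x′} x≈x′ y<x y y∈I →
        begin-strict proj₁ y <⟨ y<x y y∈I ⟩ proj₁ x ≈⟨ x≈x′ ⟩ proj₁ x′ ∎)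
    above-up : ∀ x x′ → x ∈ above → proj₁ x ≤ proj₁ x′ → x′ ∈ above
    above-up x x′ x∈ x≤x′ =
      let (y , y∈I , y≤x) = ⌊⌋-elim x∈ in ⌊⌋-intro (y , y∈I , ℝ.≤.trans y≤x x≤x′)
    beyond-up : ∀ x x′ → x ∈ beyond → proj₁ x ≤ proj₁ x′ → x′ ∈ beyond
    beyond-up x x′ x∈ x≤x′ = ⌊⌋-intro λ y y∈I →
      begin-strict proj₁ y <⟨ ⌊⌋-elim x∈ y y∈I ⟩ proj₁ x ≤⟨ x≤x′ ⟩ proj₁ x′ ∎
    within : ∀ x y → y ∈ I → proj₁ y ≤ proj₁ x →
             ¬ (∀ z → z ∈ I → proj₁ z < proj₁ x) → x ∈ I
    within x y y∈I y≤x ¬beyond with lem {∃ λ z → z ∈ I × proj₁ x ≤ proj₁ z}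
    ... | yes (z , z∈I , x≤z) = convex y x z y∈I z∈I y≤x x≤z
    ... | no none = ⊥-elim (¬beyond λ z z∈I → ≰⇒> (λ x≤z → none (z , z∈I , x≤z)))

-- The effectivity function on the quotient, from invariance and tameness.

module Quotients (lem : ExcludedMiddle 0ℓ) (ℝ : CompleteOrderedField) where

  open GameLogic lem ℝ
  open SigmaAlgebras lem ℝ
  open Evaluations lem ℝ
  open MeasurableSpace using (setoid; Measurable)
  open Equivalence using (to; from)
  open Equivalenceₛ using (Related)

  Sub-map-measurable : (S T : MeasurableSpace) (f : Func (setoid S) (setoid T))
    (m : IsMeasurable S T f) → IsMeasurable (Sub S) (Sub T) (Sub-map S T f m)
  Sub-map-measurable S T f m W = σ-preimage (Sub-map S T f m)
    (MeasurableSpace.isSigmaAlgebra (Sub S))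
    λ { W (A , A∈ , B , B∈ , W≐) → gen (f ⁻¹[ A ] , m A A∈ , B , B∈ , λ μ → W≐ _) }

  module _ (S : MeasurableSpace) (ρ : Equivalenceₛ (setoid S)) where
    private
      module S = MeasurableSpace S
      π = Sub-map S (S / ρ) (ηₛ ρ) (η-measurable S ρ)

    -- The quotient keeps the carrier, so `A` descends as the same Boolean map; invariance supplies
    -- its congruence proof.
    invariant-descend : ∀ {A} → Invariant S ρ A →
      ∃ λ B → Measurable (S / ρ) B × A ≐ ηₛ ρ ⁻¹[ B ]
    invariant-descend {A} (A∈ , inv) =
      record { to   = A ⟨$⟩_
             ; cong = λ {s} {s′} sρs′ → T-⇔⇒≡ _ _ (inv s s′ sρs′)
                 (inv s′ s (IsEquivalence.sym (Equivalenceₛ.isEquivalence ρ) sρs′)) } ,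
      S.resp (λ _ → ≡.refl) A∈ , λ _ → ≡.refl

    module _ (P : StochasticEffectivity S)
             (P-invariant : ∀ {s s′} → Related ρ s s′ → ∀ {W} → Measurable (Sub (S / ρ)) W →
               𝒱.Member (StochasticEffectivity.at P s) (π ⁻¹[ W ]) →
               𝒱.Member (StochasticEffectivity.at P s′) (π ⁻¹[ W ]))
             (tame : Tame S ρ) where
      private
        module P = StochasticEffectivity P
        𝒜 = proj₁ tame
        ρ-exact   = proj₁ (proj₂ tame)
        ρ×Δ-exact = proj₂ (proj₂ tame)

      -- Dictated by the morphism condition for the factor map; measurability of `W` is recorded
      -- because `𝒱` demands it of every member.
      Hit : ∣ setoid S ∣ → Pred (𝒫 (Subₛ (S / ρ))) 0ℓ
      Hit s W = Measurable (Sub (S / ρ)) W × 𝒱.Member (P.at s) (π ⁻¹[ W ])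

      quotientAt : ∣ setoid S ∣ → 𝒱 (S / ρ)
      quotientAt s = record
        { Member       = Hit s
        ; measurable   = proj₁
        ; upwardClosed = λ { (_ , w) W′∈ W⊆W′ → W′∈ , 𝒱.upwardClosed (P.at s) w
            (Sub-map-measurable S (S / ρ) (ηₛ ρ) (η-measurable S ρ) _ W′∈) (W⊆W′ ∘ (π ⟨$⟩_)) }
        }

      quotientAt-resp : ∀ {s s′} → Related ρ s s′ → ∀ {W} → Hit s W → Hit s′ W
      quotientAt-resp sρs′ (W∈ , w) = W∈ , P-invariant sρs′ W∈ w

      η×id : Func (setoid S ×ₛ 𝕀) (setoid (S / ρ) ×ₛ 𝕀)
      η×id = record { to = id ; cong = λ { (p , q) → Equivalenceₛ.reflexive ρ p , q } }

      π×id : Func (Subₛ S ×ₛ 𝕀) (Subₛ (S / ρ) ×ₛ 𝕀)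
      π×id = record { to = λ { (μ , q) → π ⟨$⟩ μ , q }
                    ; cong = λ { {μ , _} {ν , _} (μ≈ν , q) → Func.cong π {μ} {ν} μ≈ν , q } }

      π×id-measurable : ∀ {H} → Measurable (Sub (S / ρ) ⊗ [0,1]) H →
                        Measurable (Sub S ⊗ [0,1]) (π×id ⁻¹[ H ])
      π×id-measurable = σ-preimage π×id (σ-isSigmaAlgebra _)
        λ { E (A , B , A∈ , B∈ , E≐) → gen (π ⁻¹[ A ] , B ,
            Sub-map-measurable S (S / ρ) (ηₛ ρ) (η-measurable S ρ) A A∈ , B∈ ,
            λ { (μ , q) → E≐ _ }) }

      -- Exactness of `ρ` makes the side `A` invariant, so it descends; the side `I` stays as it is
      -- and is Borel.
      descend-rectangle : ∀ E → (∃ λ A → ∃ λ I → 𝒜 A × Interval I × E ≐ rectangle A I) →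
        ∃ λ F → Measurable ((S / ρ) ⊗ [0,1]) F × E ≐ η×id ⁻¹[ F ]
      descend-rectangle E (A , I , A∈ , I-interval , E≐)
        with invariant-descend (from (proj₂ ρ-exact A) (gen A∈))
      ... | B , B∈ , A≐B = rectangle B I ,
        gen (B , I , B∈ , Interval⇒Borel I-interval , λ _ → ≡.refl) ,
        λ { (s , q) → ≡.trans (E≐ (s , q)) (≡.cong (_∧ (I ⟨$⟩ q)) (A≐B s)) }

      -- This is `hits` for the quotient, spelled out because its measurability has to be known
      -- before the record providing `hits` can be formed.
      quotientHits : 𝒫 (Subₛ (S / ρ) ×ₛ 𝕀) → 𝒫 (setoid (S / ρ) ×ₛ 𝕀)
      quotientHits H = compr (λ { (s , q) → Hit s (section {Y = 𝕀} H q) })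
        λ { {s , q} {s′ , q′} (sρs′ , q≈q′) w → 𝒱.Member-resp (quotientAt s′)
              (λ μ → Func.cong H {μ , q} {μ , q′} (Setoid.refl (Subₛ (S / ρ)) {μ} , q≈q′))
              (quotientAt-resp sρs′ w) }

      -- Pulled back along `η×id`, the set becomes `hits` of `P` at the pulled-back `H`: measurable
      -- by t-measurability of `P`, and invariant under `ρ ×Δ`. Tameness generates it from
      -- rectangles, which descend. As `η×id` is the identity on points, the descended set is the
      -- original one.
      quotientHits-measurable : ∀ H → Measurable (Sub (S / ρ) ⊗ [0,1]) H →
        Measurable ((S / ρ) ⊗ [0,1]) (quotientHits H)
      quotientHits-measurable H H∈ with σ-descend η×id
        (σ-isSigmaAlgebra _) descend-rectangle
        (to (proj₂ ρ×Δ-exact (η×id ⁻¹[ quotientHits H ])) (pullback∈ , pullback-invariant))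
        where
        pullback≐ : P.hits (π×id ⁻¹[ H ]) ≐ η×id ⁻¹[ quotientHits H ]
        pullback≐ (s , q) = ⌊⌋-cong
          (λ w → section-measurable {Sub (S / ρ)} {[0,1]} H∈ q ,
                 𝒱.Member-resp (P.at s) (λ _ → ≡.refl) w)
          (λ { (_ , w) → 𝒱.Member-resp (P.at s) (λ _ → ≡.refl) w })
        pullback∈ : Measurable (S ⊗ [0,1]) (η×id ⁻¹[ quotientHits H ])
        pullback∈ = resp pullback≐ (P.t-measurable (π×id ⁻¹[ H ]) (π×id-measurable H∈))
        pullback-invariant : ∀ x y → Related (ρ ×Δ) x y →
          x ∈ η×id ⁻¹[ quotientHits H ] → y ∈ η×id ⁻¹[ quotientHits H ]
        pullback-invariant x y x≈y = ∈-resp (quotientHits H) {x} {y} x≈y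
      ... | F , F∈ , hits≐F = resp (λ x → ≡.sym (hits≐F x)) F∈

      quotientEffectivity : StochasticEffectivity (S / ρ)
      quotientEffectivity = record
        { at           = quotientAt
        ; at-resp      = quotientAt-resp
        ; t-measurable = λ H H∈ → resp
            (λ { (s , q) → ≡.refl })
            (quotientHits-measurable H H∈)
        }

      congruenceFor : IsCongruenceFor ρ P
      congruenceFor = quotientEffectivity , record
        { measurable = η-measurable S ρ
        ; preserves  = λ s W W∈ → mk⇔ proj₂ (W∈ ,_)
        }

-- Logical equivalence as a congruence, and its factor map.

module LogicalEquivalence (lem : ExcludedMiddle 0ℓ) (ℝ : CompleteOrderedField) where

  open GameLogic lem ℝ
  open OrderedField lem ℝ
  open SigmaAlgebras lem ℝ
  open Evaluations lem ℝ
  open Quotients lem ℝ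
  open MeasurableSpace using (setoid; Measurable)
  open Equivalence using (to; from)
  open Equivalenceₛ using (Related)
  open ℝ using (_≤_; _<_)

  module _ {Γ : Set} {ε : Γ} {Ψ : Set} (𝒢 : GameModel Γ ε Ψ)
           (frege : Frege 𝒢) (small : Small 𝒢) where
    private
      module 𝒢 = GameModel 𝒢
      S = 𝒢.space
      module S = MeasurableSpace S
      ρ = logicalEquivalence 𝒢
      π = Sub-map S (S / ρ) (ηₛ ρ) (η-measurable S ρ)
      Member : Γ → ∣ S.setoid ∣ → Pred (𝒫 (Subₛ S)) 0ℓ
      Member γ s = 𝒱.Member (StochasticEffectivity.at (𝒢.P γ) s)

    Definable : Pred (𝒫 S.setoid) 0ℓ
    Definable A = ∃ λ φ → A ≐ ⟦_⟧ 𝒢 φ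

    definable-measurable : ∀ φ → S.Measurable (⟦_⟧ 𝒢 φ)
    definable-measurable φ = proj₁ (proj₂ small) (⟦_⟧ 𝒢 φ) (gen (φ , λ _ → ≡.refl))

    -- `Small` takes a σ-algebra as its generating family, so exactness yields a doubly generated
    -- set, which is collapsed here.
    invariant⇒σ-definable : ∀ {A} → Invariant S ρ A → σ Definable A
    invariant⇒σ-definable {A} inv = idempotent (to (proj₂ (proj₂ small) A) inv)
      where
      idempotent : ∀ {A} → σ (σ Definable) A → σ Definable A
      idempotent (gen A∈)        = A∈
      idempotent (resp A≐B A∈)   = resp A≐B (idempotent A∈)
      idempotent full∈           = full∈
      idempotent (∁-closed A∈)   = ∁-closed (idempotent A∈)
      idempotent (⋃-closed A A∈) = ⋃-closed A (idempotent ∘ A∈)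

    -- The sets whose membership in an effectivity function is expressed by a formula; the Frege
    -- condition is applied to this family.
    Tested : Pred (𝒫 (Subₛ S)) 0ℓ
    Tested E = ∃ λ φ → Σ[ q ∈ ∣ 𝕀 ∣ ] E ≐ β S (⟦_⟧ 𝒢 φ) (definable-measurable φ) (proj₁ q)

    β-measurable : ∀ φ q → Measurable (Sub S) (β S (⟦_⟧ 𝒢 φ) (definable-measurable φ) q)
    β-measurable φ q = gen (⟦_⟧ 𝒢 φ , definable-measurable φ , ray ,
        upSet-Borel ray (λ x y x∈ x≤y → ⌊⌋-intro (<-≤-trans (⌊⌋-elim x∈) x≤y)) , λ _ → ≡.refl)
      where
      <-≤-trans : ∀ {x y} → q < x → x ≤ y → q < y
      <-≤-trans {x} {y} q<x x≤y = begin-strict q <⟨ q<x ⟩ x ≤⟨ x≤y ⟩ y ∎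
      ray : 𝒫 𝕀
      ray = compr (λ x → q < proj₁ x) (λ x≈y q<x → <-≤-trans q<x (ℝ.≤.reflexive x≈y))

    tested-invariant : ∀ {s s′} → Related ρ s s′ → ∀ γ {E} → Tested E →
                       Member γ s E → Member γ s′ E
    tested-invariant {s} {s′} sρs′ γ {E} (φ , q , E≐) w = transport
      (⌊⌋-elim (to (sρs′ (⟨ prim γ ⟩[ q ] φ))
        (⌊⌋-intro (definable-measurable φ , 𝒱.Member-resp (at s) E≐ w))))
      where
      at = StochasticEffectivity.at (𝒢.P γ)
      -- The modal formula returns its own measurability proof `m`; values do not depend on that
      -- proof, so the two versions of `β` coincide.
      transport : (Σ[ m ∈ S.Measurable (⟦_⟧ 𝒢 φ) ] Member γ s′ (β S (⟦_⟧ 𝒢 φ) m (proj₁ q))) →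
                  Member γ s′ E
      transport (m , w′) = 𝒱.Member-resp (at s′)
        (λ μ → let v≈v′ = Measure.value-cong μ m (definable-measurable φ) (λ _ → ≡.refl) in
          ≡.trans
            (⌊⌋-cong (λ q<v → begin-strict _ <⟨ q<v ⟩ _ ≈⟨ v≈v′ ⟩ _ ∎)
                     (λ q<v′ → begin-strict _ <⟨ q<v′ ⟩ _ ≈⟨ v≈v′ ⟨ _ ∎))
            (≡.sym (E≐ μ)))
        w′

    σ-tested-invariant : ∀ {s s′} → Related ρ s s′ → ∀ γ {E} → σ Tested E →
                         Member γ s E → Member γ s′ E
    σ-tested-invariant {s} {s′} sρs′ γ E∈ = to (proj₂ (frege s s′ γ Tested
      (λ { E t@(φ , q , E≐) → resp (λ μ → ≡.sym (E≐ μ)) (β-measurable φ (proj₁ q)) ,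
           mk⇔ (tested-invariant sρs′ γ t)
               (tested-invariant (IsEquivalence.sym (Equivalenceₛ.isEquivalence ρ) sρs′) γ t) })
      _ E∈))

    definable-evaluable : ∀ {A} → Definable A → Evaluable S (σ-isSigmaAlgebra Tested) A
    definable-evaluable (φ , A≐) = A∈ ,
      measurable-resp (λ μ → Measure.value-cong μ (definable-measurable φ) A∈ (λ x → ≡.sym (A≐ x)))
        (measurable-value S (σ-isSigmaAlgebra Tested) (definable-measurable φ)
          (λ q → gen (φ , q , λ _ → ≡.refl)))
      where
      open Events (σ-isSigmaAlgebra Tested)
      A∈ = S.resp (λ x → ≡.sym (A≐ x)) (definable-measurable φ)

    -- Conjunction makes the validity sets a π-system, as Dynkin's theorem requires.
    definable-∩ : ∀ {A B} → Definable A → Definable B → Definable (A ∩ B)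
    definable-∩ (φ , A≐) (ψ , B≐) = φ ∧ᶠ ψ , λ x → ≡.cong₂ _∧_ (A≐ x) (B≐ x)

    -- Evaluating `π ⟨$⟩ μ` at a measurable set of classes is evaluating `μ` at an invariant set,
    -- which lies in `σ Definable`; there evaluations are measurable for `σ Tested`.
    π-preimage-tested : ∀ {W} → Measurable (Sub (S / ρ)) W → σ Tested (π ⁻¹[ W ])
    π-preimage-tested = σ-preimage π (σ-isSigmaAlgebra Tested)
      λ { W (A , A∈ , B , B∈ , W≐) → resp (λ μ → ≡.sym (W≐ (π ⟨$⟩ μ)))
          (evaluation-measurable S (σ-isSigmaAlgebra Tested)
            (definable-evaluable (⊤ᶠ , λ _ → ≡.refl)) definable-evaluable
            (λ {A} {B} → definable-∩ {A} {B})
            (invariant⇒σ-definable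
              -- A set of the quotient respects `ρ` as its equality, which is invariance in `S`.
              (A∈ , λ s s′ sρs′ → ≡.subst T (Func.cong A {s} {s′} sρs′)))
            A∈ B∈) }

    isCongruence : IsCongruence 𝒢 ρ
    isCongruence = record
      { invariant  = λ p → 𝒢.V-measurable p , λ s s′ sρs′ → to (sρs′ (atom p))
      ; congruence = λ γ → congruenceFor S ρ (𝒢.P γ)
          (λ sρs′ W∈ → σ-tested-invariant sρs′ γ (π-preimage-tested W∈)) (proj₁ small)
      }

    factorMap : IsModelMorphism 𝒢 (factorModel 𝒢 ρ isCongruence) (ηₛ ρ)
    factorMap = record
      { measurable = η-measurable S ρ
      ; morphism   = λ γ → proj₂ (IsCongruence.congruence isCongruence γ)
      ; valuation  = λ p s → T-⇔⇒≡ _ _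
          (λ s∈ → let (s₀ , s₀∈V , s₀ρs) = image⁻ p s s∈ in to (s₀ρs (atom p)) s₀∈V)
          (λ s∈V → ⌊⌋-intro (s , s∈V , IsEquivalence.refl (Equivalenceₛ.isEquivalence ρ)))
      }
      where
      image⁻ : ∀ p s → s ∈ ηₛ ρ ⁻¹[ image (ηₛ ρ) (𝒢.V p) ] →
               ∃ λ s₀ → s₀ ∈ 𝒢.V p × Related ρ s₀ s
      image⁻ p s = ⌊⌋-elim

proposition6p8 : (lem : ExcludedMiddle 0ℓ) (ℝ : CompleteOrderedField) →
    let open GameLogic lem ℝ in
    (Γ : Set) (ε : Γ) (Ψ : Set) (𝒢 : GameModel Γ ε Ψ) →
    SouslinClosed (GameModel.space 𝒢) →
    Frege 𝒢 →
    Small 𝒢 →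
    let ρ = logicalEquivalence 𝒢 in
    Σ[ c ∈ IsCongruence 𝒢 ρ ] IsModelMorphism 𝒢 (factorModel 𝒢 ρ c) (ηₛ ρ)
proposition6p8 lem ℝ Γ ε Ψ 𝒢 _ frege small =
  isCongruence 𝒢 frege small , factorMap 𝒢 frege small
  where open LogicalEquivalence lem ℝ
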